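{- If $\mathcal{O}$ is a decomposable set of Scott-open modalities, then the open extension of the relation of applicative $\mathcal{O}$-bisimilarity is compatible.
   Context: Language: types $\tau ::= \mathbf{1} \mid \mathbf{N} \mid \tau \to \tau'$; signature $\Sigma$ of effect operations with arities $\alpha^n\to\alpha$, $\mathbf{N}\times\alpha^n\to\alpha$, $\alpha^{\mathbf{N}}\to\alpha$ or $\mathbf{N}\times\alpha^{\mathbf{N}}\to\alpha$. Values $V ::= * \mid Z \mid S(V) \mid \lambda x{:}\tau.M \mid x$; computations $M ::= VW \mid \mathbf{return}\,V \mid \mathbf{let}\ M\Rightarrow x\ \mathbf{in}\ N \mid \mathbf{fix}(V) \mid \mathbf{case}\ V\ \mathbf{of}\ \{Z\Rightarrow M; S(x)\Rightarrow N\} \mid \sigma(M_0,\dots) \mid \sigma(V;M_0,\dots) \mid \sigma(V)\mid\sigma(V;W)$, simply typed call-by-value. $\mathit{Val}(\tau)$, $\mathit{Com}(\tau)$: closed values/computations. Effect trees $TX$: possibly infinite trees with leaves $\bot$ or elements of $X$ and internal nodes labelled by effect operations (or $\sigma_m$, $m\in\mathbb{N}$) with $n$ or $\mathbb{N}$-many children according to arity; $t\le t'$ iff $t$ results from $t'$ by replacing subtrees with $\bot$. $\mu:TTX\to TX$ flattens trees of trees. Each $M\in\mathit{Com}(\tau)$ has an operational effect tree $|M|\in T(\mathit{Val}(\tau))$ from call-by-value evaluation. Modalities: set $\mathcal{O}$, $[\![o]\!]\subseteq T\mathbf{1}$; $t[\in P]$ replaces leaves in $P$ by $*$ and others by $\bot$;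 $o(A)=\{t\mid t[\in A]\in[\![o]\!]\}$. Scott-open: $[\![o]\!]$ upward closed, and if the supremum of an ascending chain lies in $[\![o]\!]$ then some chain element does. Decomposability: $\mathcal{T}$ is the least class containing $o(\top),o(\bot)$ closed under arbitrary $\bigvee,\bigwedge$, with $[\![o(\top)]\!]=o(\{*\})$, $[\![o(\bot)]\!]=o(\emptyset)$. $t\trianglelefteq t'$ iff $\forall\Phi\in\mathcal{T}$, $t\in[\![\Phi]\!]\Rightarrow t'\in[\![\Phi]\!]$; $r\preccurlyeq r'$ on $TT\mathbf{1}$ iff $\forall o\,\forall\Phi\in\mathcal{T}$, $r\in o([\![\Phi]\!])\Rightarrow r'\in o([\![\Phi]\!])$. $\mathcal{O}$ decomposable: $r\preccurlyeq r'\Rightarrow\mu r\trianglelefteq\mu r'$. Bisimilarity: $t\,\mathcal{O}(R)\,t'$ iff $\forall A\,\forall o$, $t\in o(A)\Rightarrow t'\in o(R[A])$, $R[A]=\{y\mid\exists x\in A,xRy\}$. An applicative $\mathcal{O}$-simulation is a family $R^v_\tau\subseteq\mathit{Val}(\tau)^2$, $R^c_\tau\subseteq\mathit{Com}(\tau)^2$ with (1) $V R^v_{\mathbf{N}}W\Rightarrow V=W$; (2) $MR^c_\tau N\Rightarrow|M|\,\mathcal{O}(R^v_\tau)\,|N|$; (3) $VR^v_{\tau'\to\tau}W\Rightarrow\forall U$, $VU\,R^c_\tau\,WU$. Applicative $\mathcal{O}$-bisimilarity is the largest symmetric applicative $\mathcal{O}$-simulation. Open extension / compatibility: $\Gamma\vdash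 M\,R^\circ\,N$ iff $M[\vec V/\vec x]\,R\,N[\vec V/\vec x]$ for all closed value instantiations of $\Gamma$; compatible means relating each variable to itself and closure under every term constructor. -}

module Defs where

open import Axiom.ExcludedMiddle using (ExcludedMiddle)
open import Data.Empty using (⊥)
open import Data.Fin using (Fin)
open import Data.List using (List; []; _∷_; _∷ʳ_)
open import Data.List.Membership.Propositional using (_∈_)
open import Data.List.Relation.Unary.Any using (here; there)
open import Data.Nat using (ℕ; zero; suc)
open import Data.Product using (Σ; Σ-syntax; ∃-syntax; _×_; _,_; proj₁; proj₂)
open import Data.Sum using (_⊎_; inj₁; inj₂)
open import Data.Sum.Properties using (inj₂-injective)
open import Data.Unit using (⊤; tt)
open import Data.Vec using (Vec; []; _∷_; lookup)
open import Data.Vec.Relation.Binary.Pointwise.Inductive using (Pointwise)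
open import Level using (0ℓ; _⊔_) renaming (suc to lsuc)
open import Relation.Binary using (Rel)
open import Relation.Binary.PropositionalEquality
  using (_≡_; refl; sym; trans; cong; subst)
open import Relation.Nullary.Decidable using (True; toWitness; fromWitness)
open import Relation.Unary using (Pred)

infixr 30 _⇒_

data Ty : Set where
  𝟏 N : Ty
  _⇒_ : Ty → Ty → Ty

data Arity : Set where
  α^_   : ℕ → Arity
  N×α^_ : ℕ → Arity
  α^N   : Arity
  N×α^N : Arity

-- The set of effect operations, fibred over their arities.
Signature : Set₁
Signature = Arity → Set

Param : Arity → Set
Param (α^ n)   = ⊤
Param (N×α^ n) = ℕ
Param α^N      = ⊤
Param N×α^N    = ℕ

Children : Arity → Set
Children (α^ n)   = Fin n
Children (N×α^ n) = Fin n
Children α^N      = ℕ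
Children N×α^N    = ℕ

module Language (Op : Signature) where

  Ctx : Set
  Ctx = List Ty

  infix 4 _⊢v_ _⊢c_

  -- Intrinsically typed de Bruijn syntax: λ-annotations are carried by the
  -- type index.  Finite families of arguments are vectors, not functions, so
  -- that propositional equality of terms is syntactic equality.
  mutual
    data _⊢v_ (Γ : Ctx) : Ty → Set where
      var : ∀ {τ} → τ ∈ Γ → Γ ⊢v τ
      *   : Γ ⊢v 𝟏
      Z   : Γ ⊢v N
      S   : Γ ⊢v N → Γ ⊢v N
      ƛ   : ∀ {ρ τ} → ρ ∷ Γ ⊢c τ → Γ ⊢v ρ ⇒ τ

    data _⊢c_ (Γ : Ctx) : Ty → Set where
      _·_     : ∀ {ρ τ} → Γ ⊢v ρ ⇒ τ → Γ ⊢v ρ → Γ ⊢c τ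
      return  : ∀ {τ} → Γ ⊢v τ → Γ ⊢c τ
      lett    : ∀ {ρ τ} → Γ ⊢c ρ → ρ ∷ Γ ⊢c τ → Γ ⊢c τ
      fix     : ∀ {ρ τ} → Γ ⊢v (ρ ⇒ τ) ⇒ (ρ ⇒ τ) → Γ ⊢c ρ ⇒ τ
      case    : ∀ {τ} → Γ ⊢v N → Γ ⊢c τ → N ∷ Γ ⊢c τ → Γ ⊢c τ
      opFin   : ∀ {τ n} → Op (α^ n) → Vec (Γ ⊢c τ) n → Γ ⊢c τ
      opNFin  : ∀ {τ n} → Op (N×α^ n) → Γ ⊢v N → Vec (Γ ⊢c τ) n → Γ ⊢c τ
      opInf   : ∀ {τ} → Op α^N → Γ ⊢v N ⇒ τ → Γ ⊢c τ
      opNInf  : ∀ {τ} → Op N×α^N → Γ ⊢v N → Γ ⊢v N ⇒ τ → Γ ⊢c τ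

  Val Com : Ty → Set
  Val τ = [] ⊢v τ
  Com τ = [] ⊢c τ

  Ren Sub : Ctx → Ctx → Set
  Ren Γ Δ = ∀ {τ} → τ ∈ Γ → τ ∈ Δ
  Sub Γ Δ = ∀ {τ} → τ ∈ Γ → Δ ⊢v τ

  liftR : ∀ {Γ Δ ρ} → Ren Γ Δ → Ren (ρ ∷ Γ) (ρ ∷ Δ)
  liftR r (here e)  = here e
  liftR r (there x) = there (r x)

  mutual
    renV : ∀ {Γ Δ τ} → Ren Γ Δ → Γ ⊢v τ → Δ ⊢v τ
    renV r (var x) = var (r x)
    renV r *       = *
    renV r Z       = Z
    renV r (S V)   = S (renV r V)
    renV r (ƛ M)   = ƛ (renC (liftR r) M)

    renC : ∀ {Γ Δ τ} → Ren Γ Δ → Γ ⊢c τ → Δ ⊢c τ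
    renC r (V · W)         = renV r V · renV r W
    renC r (return V)      = return (renV r V)
    renC r (lett M P)      = lett (renC r M) (renC (liftR r) P)
    renC r (fix V)         = fix (renV r V)
    renC r (case V M P)    = case (renV r V) (renC r M) (renC (liftR r) P)
    renC r (opFin σ Ms)    = opFin σ (renCs r Ms)
    renC r (opNFin σ V Ms) = opNFin σ (renV r V) (renCs r Ms)
    renC r (opInf σ W)     = opInf σ (renV r W)
    renC r (opNInf σ V W)  = opNInf σ (renV r V) (renV r W)

    renCs : ∀ {Γ Δ τ n} → Ren Γ Δ → Vec (Γ ⊢c τ) n → Vec (Δ ⊢c τ) n
    renCs r []       = []
    renCs r (M ∷ Ms) = renC r M ∷ renCs r Ms

  wk : ∀ {Γ ρ τ} → Γ ⊢v τ → ρ ∷ Γ ⊢v τ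
  wk = renV there

  liftS : ∀ {Γ Δ ρ} → Sub Γ Δ → Sub (ρ ∷ Γ) (ρ ∷ Δ)
  liftS s (here e)  = var (here e)
  liftS s (there x) = wk (s x)

  mutual
    subV : ∀ {Γ Δ τ} → Sub Γ Δ → Γ ⊢v τ → Δ ⊢v τ
    subV s (var x) = s x
    subV s *       = *
    subV s Z       = Z
    subV s (S V)   = S (subV s V)
    subV s (ƛ M)   = ƛ (subC (liftS s) M)

    subC : ∀ {Γ Δ τ} → Sub Γ Δ → Γ ⊢c τ → Δ ⊢c τ
    subC s (V · W)         = subV s V · subV s W
    subC s (return V)      = return (subV s V)
    subC s (lett M P)      = lett (subC s M) (subC (liftS s) P)
    subC s (fix V)         = fix (subV s V)
    subC s (case V M P)    = case (subV s V) (subC s M) (subC (liftS s) P)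
    subC s (opFin σ Ms)    = opFin σ (subCs s Ms)
    subC s (opNFin σ V Ms) = opNFin σ (subV s V) (subCs s Ms)
    subC s (opInf σ W)     = opInf σ (subV s W)
    subC s (opNInf σ V W)  = opNInf σ (subV s V) (subV s W)

    subCs : ∀ {Γ Δ τ n} → Sub Γ Δ → Vec (Γ ⊢c τ) n → Vec (Δ ⊢c τ) n
    subCs s []       = []
    subCs s (M ∷ Ms) = subC s M ∷ subCs s Ms

  single : ∀ {Γ ρ} → Γ ⊢v ρ → Sub (ρ ∷ Γ) Γ
  single V (here refl) = V
  single V (there x)   = var x

  infix 25 _[_]

  _[_] : ∀ {Γ ρ τ} → ρ ∷ Γ ⊢c τ → Γ ⊢v ρ → Γ ⊢c τ
  M [ V ] = subC (single V) M

  toℕ : Val N → ℕ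
  toℕ Z     = zero
  toℕ (S V) = suc (toℕ V)

  numeral : ℕ → Val N
  numeral zero    = Z
  numeral (suc n) = S (numeral n)

  -- Labels σ or σ_m of internal nodes.
  record Node : Set where
    constructor node
    field
      {arity} : Arity
      op      : Op arity
      param   : Param arity

  Branch : Node → Set
  Branch ν = Children (Node.arity ν)

  Path : Set
  Path = List (Σ Node Branch)

  -- A possibly infinite tree, as a prefix-closed partial labelling of paths; an
  -- undefined root, or an undefined position directly below an internal node, is
  -- a leaf ⊥.  Definedness need not be decidable, and may have several proofs;
  -- `unique` says that the label depends on the position only.
  record T {c} (X : Set c) : Set (lsuc 0ℓ ⊔ c) where
    field
      Defined : Path → Set
      label   : ∀ {p} → Defined p → X ⊎ Node
      unique  : ∀ {p} (d d' : Defined p) → label d ≡ label d'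
      parent  : ∀ p {ν} {i : Branch ν} → Defined (p ∷ʳ (ν , i)) →
                Σ[ d ∈ Defined p ] label d ≡ inj₂ ν

  open T public

  infix 4 _≤_

  _≤_ : ∀ {c} {X : Set c} → T X → T X → Set c
  t ≤ t' = ∀ {p} (d : Defined t p) → Σ[ d' ∈ Defined t' p ] label t d ≡ label t' d'

  IsSup : (ℕ → T ⊤) → T ⊤ → Set₁
  IsSup ts s = (∀ n → ts n ≤ s) × (∀ u → (∀ n → ts n ≤ u) → s ≤ u)

  module _ {c} {X : Set c} (P : Pred X 0ℓ) where

    Keep : X ⊎ Node → Set
    Keep (inj₁ x) = P x
    Keep (inj₂ ν) = ⊤

    forget : X ⊎ Node → ⊤ ⊎ Node
    forget (inj₁ x) = inj₁ tt
    forget (inj₂ ν) = inj₂ ν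

    restrict : T X → T ⊤
    restrict t .Defined p                 = Σ[ d ∈ Defined t p ] Keep (label t d)
    restrict t .label (d , _)             = forget (label t d)
    restrict t .unique (d , _) (d' , _)   = cong forget (unique t d d')
    restrict t .parent p (d , _) with parent t p d
    ... | d₀ , e = (d₀ , subst Keep (sym e) tt) , cong forget e

  infix 25 _[∈_]

  _[∈_] : ∀ {c} {X : Set c} → T X → Pred X 0ℓ → T ⊤
  t [∈ P ] = restrict P t

  subtree : ∀ {c} {X : Set c} (x : Σ Node Branch) → T X → T X
  subtree x t .Defined p    = Defined t (x ∷ p)
  subtree x t .label d      = label t d
  subtree x t .unique d d'  = unique t d d'
  subtree x t .parent p d   = parent t (x ∷ p) d

  module _ {c} {X : Set c} where

    -- Follow a path from the root of r; on meeting a leaf t of r, continue in t.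
    mutual
      μDefined : T (T X) → Path → Set
      μDefined r p = Σ[ d ∈ Defined r [] ] μBelow r (label r d) p

      μBelow : T (T X) → T X ⊎ Node → Path → Set
      μBelow r (inj₁ t) p       = Defined t p
      μBelow r (inj₂ ν) []      = ⊤
      μBelow r (inj₂ ν) (x ∷ p) = μDefined (subtree x r) p

    mutual
      μLabel : ∀ r p → μDefined r p → X ⊎ Node
      μLabel r p (d , b) = μLabelBelow r (label r d) p b

      μLabelBelow : ∀ r l p → μBelow r l p → X ⊎ Node
      μLabelBelow r (inj₁ t) p       b = label t b
      μLabelBelow r (inj₂ ν) []      b = inj₂ ν
      μLabelBelow r (inj₂ ν) (x ∷ p) b = μLabel (subtree x r) p b

    mutual
      μUnique : ∀ r p (d d' : μDefined r p) → μLabel r p d ≡ μLabel r p d'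
      μUnique r p (d , b) (d' , b') = μUniqueBelow r p _ _ (unique r d d') b b'

      μUniqueBelow : ∀ r p l l' → l ≡ l' → (b : μBelow r l p) (b' : μBelow r l' p) →
                     μLabelBelow r l p b ≡ μLabelBelow r l' p b'
      μUniqueBelow r p       (inj₁ t) .(inj₁ t) refl b b' = unique t b b'
      μUniqueBelow r []      (inj₂ ν) .(inj₂ ν) refl b b' = refl
      μUniqueBelow r (x ∷ p) (inj₂ ν) .(inj₂ ν) refl b b' = μUnique (subtree x r) p b b'

    mutual
      μParent : ∀ r p {ν} {i : Branch ν} → μDefined r (p ∷ʳ (ν , i)) →
                Σ[ d ∈ μDefined r p ] μLabel r p d ≡ inj₂ ν
      μParent r p (d , b) with μParentBelow r p d (label r d) refl b
      ... | b' , e = (d , b') , e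

      μParentBelow : ∀ r p {ν} {i : Branch ν} (d : Defined r []) l → label r d ≡ l →
                     μBelow r l (p ∷ʳ (ν , i)) →
                     Σ[ b ∈ μBelow r l p ] μLabelBelow r l p b ≡ inj₂ ν
      μParentBelow r p       d (inj₁ t) e b = parent t p b
      μParentBelow r []      d (inj₂ ν) e (d₁ , _) with parent r [] d₁
      ... | d₀ , e₀ = tt , cong inj₂ (inj₂-injective (trans (sym e) (trans (unique r d d₀) e₀)))
      μParentBelow r (x ∷ p) d (inj₂ ν) e b = μParent (subtree x r) p b

    μ : T (T X) → T X
    μ r .Defined p    = μDefined r p
    μ r .label {p}    = μLabel r p
    μ r .unique {p}   = μUnique r p
    μ r .parent p     = μParent r p

  data Step (τ : Ty) : Set where
    next : Com τ → Step τ
    val  : Val τ → Step τ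
    op   : (ν : Node) → (Branch ν → Com τ) → Step τ

  mutual
    step : ∀ {τ} → Com τ → Step τ
    step (ƛ M · V)         = next (M [ V ])
    step (return V)        = val V
    step (lett M P)        = stepLet (step M) P
    -- fix(F) ↝ return λx. let F (λy. let fix(F) ⇒ z in z y) ⇒ w in w x
    step (fix F)           = next (return (ƛ (lett (wk F · ƛ (lett (fix (wk (wk F)))
                               (var (here refl) · var (there (here refl)))))
                               (var (here refl) · var (there (here refl))))))
    step (case Z M P)      = next M
    step (case (S V) M P)  = next (P [ V ])
    step (opFin σ Ms)      = op (node σ tt) (lookup Ms)
    step (opNFin σ V Ms)   = op (node σ (toℕ V)) (lookup Ms)
    step (opInf σ W)       = op (node σ tt) (λ n → W · numeral n)
    step (opNInf σ V W)    = op (node σ (toℕ V)) (λ n → W · numeral n)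

    stepLet : ∀ {ρ τ} → Step ρ → ρ ∷ [] ⊢c τ → Step τ
    stepLet (next M) P = next (lett M P)
    stepLet (val V)  P = next (P [ V ])
    stepLet (op ν k) P = op ν (λ i → lett (k i) P)

  -- M at p ⇓ l: the effect tree of M has label l at position p.
  infix 4 _at_⇓_

  data _at_⇓_ {τ} : Com τ → Path → Val τ ⊎ Node → Set where
    stepping : ∀ {M M' p l} → step M ≡ next M' → M' at p ⇓ l → M at p ⇓ l
    leaf     : ∀ {M V} → step M ≡ val V → M at [] ⇓ inj₁ V
    root     : ∀ {M ν k} → step M ≡ op ν k → M at [] ⇓ inj₂ ν
    child    : ∀ {M ν k i p l} → step M ≡ op ν k → k i at p ⇓ l → M at (ν , i) ∷ p ⇓ l

  ⇓-unique : ∀ {τ} {M : Com τ} {p l l'} → M at p ⇓ l → M at p ⇓ l' → l ≡ l'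
  ⇓-unique (stepping e h) (stepping e' h') with trans (sym e) e'
  ... | refl = ⇓-unique h h'
  ⇓-unique (leaf e) (leaf e') with trans (sym e) e'
  ... | refl = refl
  ⇓-unique (root e) (root e') with trans (sym e) e'
  ... | refl = refl
  ⇓-unique (child e h) (child e' h') with trans (sym e) e'
  ... | refl = ⇓-unique h h'
  ⇓-unique (stepping e _) (leaf e')     with () ← trans (sym e) e'
  ⇓-unique (stepping e _) (root e')     with () ← trans (sym e) e'
  ⇓-unique (stepping e _) (child e' _)  with () ← trans (sym e) e'
  ⇓-unique (leaf e)    (stepping e' _)  with () ← trans (sym e) e'
  ⇓-unique (leaf e)    (root e')        with () ← trans (sym e) e'
  ⇓-unique (root e)    (stepping e' _)  with () ← trans (sym e) e'
  ⇓-unique (root e)    (leaf e')        with () ← trans (sym e) e'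
  ⇓-unique (child e _) (stepping e' _)  with () ← trans (sym e) e'

  ⇓-parent : ∀ {τ} {M : Com τ} p {ν} {i : Branch ν} {l} →
             M at p ∷ʳ (ν , i) ⇓ l → M at p ⇓ inj₂ ν
  ⇓-parent []      (stepping e h) = stepping e (⇓-parent [] h)
  ⇓-parent []      (child e h)    = root e
  ⇓-parent (_ ∷ p) (stepping e h) = stepping e (⇓-parent (_ ∷ p) h)
  ⇓-parent (_ ∷ p) (child e h)    = child e (⇓-parent p h)

  ∣_∣ : ∀ {τ} → Com τ → T (Val τ)
  ∣ M ∣ .Defined p               = ∃[ l ] M at p ⇓ l
  ∣ M ∣ .label                   = proj₁
  ∣ M ∣ .unique (_ , h) (_ , h') = ⇓-unique h h'
  ∣ M ∣ .parent p (_ , h)        = (_ , ⇓-parent p h) , refl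

  record ScottOpen (U : Pred (T ⊤) 0ℓ) : Set₁ where
    field
      upward : ∀ {t t'} → t ≤ t' → U t → U t'
      chain  : ∀ ts → (∀ n → ts n ≤ ts (suc n)) → ∀ s → IsSup ts s → U s → ∃[ n ] U (ts n)

  open ScottOpen public

  record TypedRel : Set₁ where
    field
      onVal : ∀ {τ} → Rel (Val τ) 0ℓ
      onCom : ∀ {τ} → Rel (Com τ) 0ℓ

  open TypedRel public

  infix 4 _⊆_

  _⊆_ : TypedRel → TypedRel → Set
  R ⊆ Q = (∀ {τ} {V W : Val τ} → onVal R V W → onVal Q V W)
        × (∀ {τ} {M P : Com τ} → onCom R M P → onCom Q M P)

  Symmetric : TypedRel → Set
  Symmetric R = (∀ {τ} {V W : Val τ} → onVal R V W → onVal R W V)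
              × (∀ {τ} {M P : Com τ} → onCom R M P → onCom R P M)

  record OpenRel : Set₁ where
    field
      onVal° : ∀ Γ {τ} → Rel (Γ ⊢v τ) 0ℓ
      onCom° : ∀ Γ {τ} → Rel (Γ ⊢c τ) 0ℓ

  open OpenRel public

  infix 30 _°

  _° : TypedRel → OpenRel
  (R °) .onVal° Γ V W = (s : Sub Γ []) → onVal R (subV s V) (subV s W)
  (R °) .onCom° Γ M P = (s : Sub Γ []) → onCom R (subC s M) (subC s P)

  record Compatible (R : OpenRel) : Set where
    private
      infix 4 _⊢_≈v_ _⊢_≈c_

      _⊢_≈v_ : ∀ Γ {τ} → Rel (Γ ⊢v τ) 0ℓ
      _⊢_≈v_ = onVal° R

      _⊢_≈c_ : ∀ Γ {τ} → Rel (Γ ⊢c τ) 0ℓ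
      _⊢_≈c_ = onCom° R

    field
      var-compat    : ∀ {Γ τ} (x : τ ∈ Γ) → Γ ⊢ var x ≈v var x
      *-compat      : ∀ {Γ} → Γ ⊢ * ≈v *
      Z-compat      : ∀ {Γ} → Γ ⊢ Z ≈v Z
      S-compat      : ∀ {Γ} {V V' : Γ ⊢v N} → Γ ⊢ V ≈v V' → Γ ⊢ S V ≈v S V'
      ƛ-compat      : ∀ {Γ ρ τ} {M M' : ρ ∷ Γ ⊢c τ} → (ρ ∷ Γ) ⊢ M ≈c M' → Γ ⊢ ƛ M ≈v ƛ M'
      ·-compat      : ∀ {Γ ρ τ} {V V' : Γ ⊢v ρ ⇒ τ} {W W' : Γ ⊢v ρ} →
                      Γ ⊢ V ≈v V' → Γ ⊢ W ≈v W' → Γ ⊢ V · W ≈c V' · W'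
      return-compat : ∀ {Γ τ} {V V' : Γ ⊢v τ} → Γ ⊢ V ≈v V' → Γ ⊢ return V ≈c return V'
      let-compat    : ∀ {Γ ρ τ} {M M' : Γ ⊢c ρ} {P P' : ρ ∷ Γ ⊢c τ} →
                      Γ ⊢ M ≈c M' → (ρ ∷ Γ) ⊢ P ≈c P' → Γ ⊢ lett M P ≈c lett M' P'
      fix-compat    : ∀ {Γ ρ τ} {V V' : Γ ⊢v (ρ ⇒ τ) ⇒ (ρ ⇒ τ)} →
                      Γ ⊢ V ≈v V' → Γ ⊢ fix V ≈c fix V'
      case-compat   : ∀ {Γ τ} {V V' : Γ ⊢v N} {M M' : Γ ⊢c τ} {P P' : N ∷ Γ ⊢c τ} →
                      Γ ⊢ V ≈v V' → Γ ⊢ M ≈c M' → (N ∷ Γ) ⊢ P ≈c P' →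
                      Γ ⊢ case V M P ≈c case V' M' P'
      opFin-compat  : ∀ {Γ τ n} (σ : Op (α^ n)) {Ms Ms' : Vec (Γ ⊢c τ) n} →
                      Pointwise (λ M M' → Γ ⊢ M ≈c M') Ms Ms' →
                      Γ ⊢ opFin σ Ms ≈c opFin σ Ms'
      opNFin-compat : ∀ {Γ τ n} (σ : Op (N×α^ n)) {V V' : Γ ⊢v N} {Ms Ms' : Vec (Γ ⊢c τ) n} →
                      Γ ⊢ V ≈v V' → Pointwise (λ M M' → Γ ⊢ M ≈c M') Ms Ms' →
                      Γ ⊢ opNFin σ V Ms ≈c opNFin σ V' Ms'
      opInf-compat  : ∀ {Γ τ} (σ : Op α^N) {W W' : Γ ⊢v N ⇒ τ} →
                      Γ ⊢ W ≈v W' → Γ ⊢ opInf σ W ≈c opInf σ W'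
      opNInf-compat : ∀ {Γ τ} (σ : Op N×α^N) {V V' : Γ ⊢v N} {W W' : Γ ⊢v N ⇒ τ} →
                      Γ ⊢ V ≈v V' → Γ ⊢ W ≈v W' → Γ ⊢ opNInf σ V W ≈c opNInf σ V' W'

  module Modalities {O : Set} (⟦_⟧ : O → Pred (T ⊤) 0ℓ) where

    infix 30 _⟨_⟩

    _⟨_⟩ : ∀ {c} {X : Set c} → O → Pred X 0ℓ → Pred (T X) 0ℓ
    (o ⟨ A ⟩) t = ⟦ o ⟧ (t [∈ A ])

    data 𝒯 : Set₁ where
      _⊤′ _⊥′ : O → 𝒯
      ⋁ ⋀     : (I : Set) → (I → 𝒯) → 𝒯

    ⟦_⟧𝒯 : 𝒯 → Pred (T ⊤) 0ℓ
    ⟦ o ⊤′ ⟧𝒯  = o ⟨ (λ _ → ⊤) ⟩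
    ⟦ o ⊥′ ⟧𝒯  = o ⟨ (λ _ → ⊥) ⟩
    ⟦ ⋁ I Φ ⟧𝒯 = λ t → Σ[ i ∈ I ] ⟦ Φ i ⟧𝒯 t
    ⟦ ⋀ I Φ ⟧𝒯 = λ t → (i : I) → ⟦ Φ i ⟧𝒯 t

    infix 4 _⊴_ _≼_

    _⊴_ : T ⊤ → T ⊤ → Set₁
    t ⊴ t' = ∀ Φ → ⟦ Φ ⟧𝒯 t → ⟦ Φ ⟧𝒯 t'

    _≼_ : T (T ⊤) → T (T ⊤) → Set₁
    r ≼ r' = ∀ o Φ → (o ⟨ ⟦ Φ ⟧𝒯 ⟩) r → (o ⟨ ⟦ Φ ⟧𝒯 ⟩) r'

    Decomposable : Set₁
    Decomposable = ∀ {r r'} → r ≼ r' → μ r ⊴ μ r'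

    Image : ∀ {X : Set} → Rel X 0ℓ → Pred X 0ℓ → Pred X 0ℓ
    Image R A y = ∃[ x ] A x × R x y

    Lift : ∀ {X : Set} → Rel X 0ℓ → Rel (T X) (lsuc 0ℓ)
    Lift R t t' = ∀ A o → (o ⟨ A ⟩) t → (o ⟨ Image R A ⟩) t'

    record IsSimulation (R : TypedRel) : Set₁ where
      field
        sim-N : ∀ {V W : Val N} → onVal R V W → V ≡ W
        sim-c : ∀ {τ} {M P : Com τ} → onCom R M P → Lift (onVal R) ∣ M ∣ ∣ P ∣
        sim-⇒ : ∀ {ρ τ} {V W : Val (ρ ⇒ τ)} → onVal R V W →
                ∀ (U : Val ρ) → onCom R (V · U) (W · U)

    open IsSimulation public

    -- "The largest symmetric applicative simulation", as a universal property: the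
    -- union of all such relations is quantified over Set₁, so it is not itself a
    -- TypedRel without a resizing principle (see `bisimilarity` below).
    record IsBisimilarity (B : TypedRel) : Set₁ where
      field
        symmetric  : Symmetric B
        simulation : IsSimulation B
        largest    : ∀ R → Symmetric R → IsSimulation R → R ⊆ B

    open IsBisimilarity public

    keep-mono : ∀ {X : Set} {P Q : Pred X 0ℓ} → (∀ {x} → P x → Q x) → ∀ l → Keep P l → Keep Q l
    keep-mono f (inj₁ x) k = f k
    keep-mono f (inj₂ ν) k = tt

    forget-eq : ∀ {X : Set} (P Q : Pred X 0ℓ) l → forget P l ≡ forget Q l
    forget-eq P Q (inj₁ x) = refl
    forget-eq P Q (inj₂ ν) = refl

    restrict-mono : ∀ {X : Set} {P Q : Pred X 0ℓ} (t : T X) →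
                    (∀ {x} → P x → Q x) → t [∈ P ] ≤ t [∈ Q ]
    restrict-mono {P = P} {Q} t f (d , k) =
      (d , keep-mono {P = P} {Q} f (label t d) k) , forget-eq P Q (label t d)

    Lift-mono : (∀ o → ScottOpen ⟦ o ⟧) → ∀ {X : Set} {R Q : Rel X 0ℓ} (t t' : T X) →
                (∀ {x y} → R x y → Q x y) → Lift R t t' → Lift Q t t'
    Lift-mono open-⟦⟧ {R = R} {Q} t t' f l A o m =
      upward (open-⟦⟧ o)
             (restrict-mono {P = Image R A} {Image Q A} t' (λ (x , a , h) → x , a , f h))
             (l A o m)

    -- Classically the universal property is always satisfied.
    module _ (em : ExcludedMiddle (lsuc 0ℓ)) where

      InSome : (TypedRel → Set) → Set₁
      InSome F = Σ[ R ∈ TypedRel ] Symmetric R × IsSimulation R × F R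

      bisimilarity : TypedRel
      bisimilarity .onVal V W = True (em {InSome (λ R → onVal R V W)})
      bisimilarity .onCom M P = True (em {InSome (λ R → onCom R M P)})

      above : ∀ R → Symmetric R → IsSimulation R → R ⊆ bisimilarity
      above R s sim = (λ h → fromWitness (R , s , sim , h)) , (λ h → fromWitness (R , s , sim , h))

      isBisimilarity : (∀ o → ScottOpen ⟦ o ⟧) → IsBisimilarity bisimilarity
      isBisimilarity open-⟦⟧ .symmetric .proj₁ b with toWitness b
      ... | R , s , sim , h = proj₁ (above R s sim) (proj₁ s h)
      isBisimilarity open-⟦⟧ .symmetric .proj₂ b with toWitness b
      ... | R , s , sim , h = proj₂ (above R s sim) (proj₂ s h)
      isBisimilarity open-⟦⟧ .simulation .sim-N b with toWitness b
      ... | R , s , sim , h = sim-N sim h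
      isBisimilarity open-⟦⟧ .simulation .sim-c {M = M} {P} b with toWitness b
      ... | R , s , sim , h = Lift-mono open-⟦⟧ ∣ M ∣ ∣ P ∣ (proj₁ (above R s sim)) (sim-c sim h)
      isBisimilarity open-⟦⟧ .simulation .sim-⇒ b U with toWitness b
      ... | R , s , sim , h = proj₂ (above R s sim) (sim-⇒ sim h U)
      isBisimilarity open-⟦⟧ .largest = above

{-# OPTIONS --safe #-}

-- Howe's method.  The Howe closure of bisimilarity is compatible and
-- substitutive by construction, and its reflexive-transitive closure is
-- symmetric because bisimilarity is.  It remains to see that the Howe closure is
-- a simulation.  Scott-openness allows us to replace the tree of the left-hand
-- computation by a finite-fuel approximation, and we argue by induction on fuel.
-- The tree of a sequencing or of an operation is a bind, and decomposability
-- says precisely that relation lifting is compatible with bind.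

module Submission where

open import Defs
open import Data.Empty using (⊥)
open import Data.List using ([]; _∷_; _∷ʳ_; _++_)
open import Data.List.Membership.Propositional using (_∈_)
open import Data.List.Properties using (++-assoc)
open import Data.List.Relation.Unary.Any using (here; there)
open import Data.Nat using (ℕ; zero; suc; _⊔_; _≤′_; ≤′-refl; ≤′-step)
open import Data.Nat.Properties using (m≤m⊔n; m≤n⊔m; ≤⇒≤′)
open import Data.Product using (Σ-syntax; ∃-syntax; _×_; _,_; proj₁; proj₂)
open import Data.Sum using (_⊎_; inj₁; inj₂; map₁)
open import Data.Unit using (⊤; tt)
open import Data.Vec using (Vec; []; _∷_; lookup)
open import Data.Vec.Relation.Binary.Pointwise.Inductive as Pointwise using (Pointwise; []; _∷_)
open import Level using (0ℓ)
open import Relation.Binary using (Rel)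
open import Relation.Binary.Construct.Closure.ReflexiveTransitive using (Star; ε; _◅_; _◅◅_; gmap)
open import Relation.Binary.PropositionalEquality
  using (_≡_; refl; sym; trans; cong; cong₂; subst; subst₂)
open import Relation.Unary using (Pred)

-- Small steps run the first computation of a sequencing one node at a time, whereas decomposability
-- speaks of flattening whole trees of trees. Hence `approx n M` is not a truncated small-step run:
-- it follows the big-step reading of terms, so that `lett` and the operations are literally a
-- `bind`, and the head and all its continuations are available at smaller fuel. The price is to
-- show that the approximants increase and have the small-step tree as their supremum. Only the
-- left-hand side is approximated; it is compared with the whole tree on the right, so the two
-- computations need not proceed in lockstep.
--
-- Each Howe derivation ends with a bisimilarity step on its right. Reversal moves that step to the
-- left and has to reverse the subderivations as well, so one derivation turns into a chain of
-- derivations. This is why the chains, and not the Howe closure itself, are offered to the largest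
-- symmetric simulation.

module Syntax (Op : Signature) where
  open Language Op

  -- The contractum that `step` gives to `fix F`, named so that approximants and Howe derivations
  -- can refer to it.
  unfold : ∀ {ρ τ} → Val ((ρ ⇒ τ) ⇒ (ρ ⇒ τ)) → Com (ρ ⇒ τ)
  unfold F = return (ƛ (lett (wk F · ƛ (lett (fix (wk (wk F)))
               (var (here refl) · var (there (here refl)))))
               (var (here refl) · var (there (here refl)))))

  cong-case : ∀ {Γ τ} {V V' : Γ ⊢v N} {M M' : Γ ⊢c τ} {P P' : N ∷ Γ ⊢c τ} →
              V ≡ V' → M ≡ M' → P ≡ P' → case V M P ≡ case V' M' P'
  cong-case refl refl refl = refl

  -- Identity and fusion laws of renaming and substitution.

  liftS-id : ∀ {Γ ρ} {s : Sub Γ Γ} → (∀ {τ} (x : τ ∈ Γ) → s x ≡ var x) →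
             ∀ {τ} (x : τ ∈ ρ ∷ Γ) → liftS s x ≡ var x
  liftS-id e (here refl) = refl
  liftS-id e (there x)   = cong wk (e x)

  mutual
    -- Substitutions are functions, so equations between them are assumed pointwise, here and in the
    -- fusion laws; a pointwise hypothesis lifts under binders without function extensionality.
    sub-idV : ∀ {Γ τ} {s : Sub Γ Γ} → (∀ {τ} (x : τ ∈ Γ) → s x ≡ var x) →
              (V : Γ ⊢v τ) → subV s V ≡ V
    sub-idV e (var x) = e x
    sub-idV e *       = refl
    sub-idV e Z       = refl
    sub-idV e (S V)   = cong S (sub-idV e V)
    sub-idV e (ƛ M)   = cong ƛ (sub-idC (liftS-id e) M)

    sub-idC : ∀ {Γ τ} {s : Sub Γ Γ} → (∀ {τ} (x : τ ∈ Γ) → s x ≡ var x) →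
              (M : Γ ⊢c τ) → subC s M ≡ M
    sub-idC e (V · W)         = cong₂ _·_ (sub-idV e V) (sub-idV e W)
    sub-idC e (return V)      = cong return (sub-idV e V)
    sub-idC e (lett M P)      = cong₂ lett (sub-idC e M) (sub-idC (liftS-id e) P)
    sub-idC e (fix V)         = cong fix (sub-idV e V)
    sub-idC e (case V M P)    = cong-case (sub-idV e V) (sub-idC e M) (sub-idC (liftS-id e) P)
    sub-idC e (opFin σ Ms)    = cong (opFin σ) (sub-idCs e Ms)
    sub-idC e (opNFin σ V Ms) = cong₂ (opNFin σ) (sub-idV e V) (sub-idCs e Ms)
    sub-idC e (opInf σ W)     = cong (opInf σ) (sub-idV e W)
    sub-idC e (opNInf σ V W)  = cong₂ (opNInf σ) (sub-idV e V) (sub-idV e W)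

    sub-idCs : ∀ {Γ τ n} {s : Sub Γ Γ} → (∀ {τ} (x : τ ∈ Γ) → s x ≡ var x) →
               (Ms : Vec (Γ ⊢c τ) n) → subCs s Ms ≡ Ms
    sub-idCs e []       = refl
    sub-idCs e (M ∷ Ms) = cong₂ _∷_ (sub-idC e M) (sub-idCs e Ms)

  liftR-liftR : ∀ {Γ Δ Θ ρ} {r : Ren Γ Δ} {r' : Ren Δ Θ} {r″ : Ren Γ Θ} →
                (∀ {τ} (x : τ ∈ Γ) → r' (r x) ≡ r″ x) →
                ∀ {τ} (x : τ ∈ ρ ∷ Γ) → liftR r' (liftR r x) ≡ liftR r″ x
  liftR-liftR e (here _)  = refl
  liftR-liftR e (there x) = cong there (e x)

  mutual
    ren-renV : ∀ {Γ Δ Θ τ} {r : Ren Γ Δ} {r' : Ren Δ Θ} {r″ : Ren Γ Θ} →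
               (∀ {τ} (x : τ ∈ Γ) → r' (r x) ≡ r″ x) →
               (V : Γ ⊢v τ) → renV r' (renV r V) ≡ renV r″ V
    ren-renV e (var x) = cong var (e x)
    ren-renV e *       = refl
    ren-renV e Z       = refl
    ren-renV e (S V)   = cong S (ren-renV e V)
    ren-renV e (ƛ M)   = cong ƛ (ren-renC (liftR-liftR e) M)

    ren-renC : ∀ {Γ Δ Θ τ} {r : Ren Γ Δ} {r' : Ren Δ Θ} {r″ : Ren Γ Θ} →
               (∀ {τ} (x : τ ∈ Γ) → r' (r x) ≡ r″ x) →
               (M : Γ ⊢c τ) → renC r' (renC r M) ≡ renC r″ M
    ren-renC e (V · W)         = cong₂ _·_ (ren-renV e V) (ren-renV e W)
    ren-renC e (return V)      = cong return (ren-renV e V)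
    ren-renC e (lett M P)      = cong₂ lett (ren-renC e M) (ren-renC (liftR-liftR e) P)
    ren-renC e (fix V)         = cong fix (ren-renV e V)
    ren-renC e (case V M P)    =
      cong-case (ren-renV e V) (ren-renC e M) (ren-renC (liftR-liftR e) P)
    ren-renC e (opFin σ Ms)    = cong (opFin σ) (ren-renCs e Ms)
    ren-renC e (opNFin σ V Ms) = cong₂ (opNFin σ) (ren-renV e V) (ren-renCs e Ms)
    ren-renC e (opInf σ W)     = cong (opInf σ) (ren-renV e W)
    ren-renC e (opNInf σ V W)  = cong₂ (opNInf σ) (ren-renV e V) (ren-renV e W)

    ren-renCs : ∀ {Γ Δ Θ τ n} {r : Ren Γ Δ} {r' : Ren Δ Θ} {r″ : Ren Γ Θ} →
                (∀ {τ} (x : τ ∈ Γ) → r' (r x) ≡ r″ x) →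
                (Ms : Vec (Γ ⊢c τ) n) → renCs r' (renCs r Ms) ≡ renCs r″ Ms
    ren-renCs e []       = refl
    ren-renCs e (M ∷ Ms) = cong₂ _∷_ (ren-renC e M) (ren-renCs e Ms)

  liftS-liftR : ∀ {Γ Δ Θ ρ} {r : Ren Γ Δ} {s : Sub Δ Θ} {s' : Sub Γ Θ} →
                (∀ {τ} (x : τ ∈ Γ) → s (r x) ≡ s' x) →
                ∀ {τ} (x : τ ∈ ρ ∷ Γ) → liftS s (liftR r x) ≡ liftS s' x
  liftS-liftR e (here _)  = refl
  liftS-liftR e (there x) = cong wk (e x)

  mutual
    sub-renV : ∀ {Γ Δ Θ τ} {r : Ren Γ Δ} {s : Sub Δ Θ} {s' : Sub Γ Θ} →
               (∀ {τ} (x : τ ∈ Γ) → s (r x) ≡ s' x) →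
               (V : Γ ⊢v τ) → subV s (renV r V) ≡ subV s' V
    sub-renV e (var x) = e x
    sub-renV e *       = refl
    sub-renV e Z       = refl
    sub-renV e (S V)   = cong S (sub-renV e V)
    sub-renV e (ƛ M)   = cong ƛ (sub-renC (liftS-liftR e) M)

    sub-renC : ∀ {Γ Δ Θ τ} {r : Ren Γ Δ} {s : Sub Δ Θ} {s' : Sub Γ Θ} →
               (∀ {τ} (x : τ ∈ Γ) → s (r x) ≡ s' x) →
               (M : Γ ⊢c τ) → subC s (renC r M) ≡ subC s' M
    sub-renC e (V · W)         = cong₂ _·_ (sub-renV e V) (sub-renV e W)
    sub-renC e (return V)      = cong return (sub-renV e V)
    sub-renC e (lett M P)      = cong₂ lett (sub-renC e M) (sub-renC (liftS-liftR e) P)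
    sub-renC e (fix V)         = cong fix (sub-renV e V)
    sub-renC e (case V M P)    =
      cong-case (sub-renV e V) (sub-renC e M) (sub-renC (liftS-liftR e) P)
    sub-renC e (opFin σ Ms)    = cong (opFin σ) (sub-renCs e Ms)
    sub-renC e (opNFin σ V Ms) = cong₂ (opNFin σ) (sub-renV e V) (sub-renCs e Ms)
    sub-renC e (opInf σ W)     = cong (opInf σ) (sub-renV e W)
    sub-renC e (opNInf σ V W)  = cong₂ (opNInf σ) (sub-renV e V) (sub-renV e W)

    sub-renCs : ∀ {Γ Δ Θ τ n} {r : Ren Γ Δ} {s : Sub Δ Θ} {s' : Sub Γ Θ} →
                (∀ {τ} (x : τ ∈ Γ) → s (r x) ≡ s' x) →
                (Ms : Vec (Γ ⊢c τ) n) → subCs s (renCs r Ms) ≡ subCs s' Ms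
    sub-renCs e []       = refl
    sub-renCs e (M ∷ Ms) = cong₂ _∷_ (sub-renC e M) (sub-renCs e Ms)

  liftR-liftS : ∀ {Γ Δ Θ ρ} {s : Sub Γ Δ} {r : Ren Δ Θ} {s' : Sub Γ Θ} →
                (∀ {τ} (x : τ ∈ Γ) → renV r (s x) ≡ s' x) →
                ∀ {τ} (x : τ ∈ ρ ∷ Γ) → renV (liftR r) (liftS s x) ≡ liftS s' x
  liftR-liftS e (here _)          = refl
  liftR-liftS {s = s} e (there x) =
    -- Weakening commutes with `r` because both composites fuse into one renaming, along `r`
    -- followed by `there`.
    trans (ren-renV (λ _ → refl) (s x)) (trans (sym (ren-renV (λ _ → refl) (s x))) (cong wk (e x)))

  mutual
    ren-subV : ∀ {Γ Δ Θ τ} {s : Sub Γ Δ} {r : Ren Δ Θ} {s' : Sub Γ Θ} →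
               (∀ {τ} (x : τ ∈ Γ) → renV r (s x) ≡ s' x) →
               (V : Γ ⊢v τ) → renV r (subV s V) ≡ subV s' V
    ren-subV e (var x) = e x
    ren-subV e *       = refl
    ren-subV e Z       = refl
    ren-subV e (S V)   = cong S (ren-subV e V)
    ren-subV e (ƛ M)   = cong ƛ (ren-subC (liftR-liftS e) M)

    ren-subC : ∀ {Γ Δ Θ τ} {s : Sub Γ Δ} {r : Ren Δ Θ} {s' : Sub Γ Θ} →
               (∀ {τ} (x : τ ∈ Γ) → renV r (s x) ≡ s' x) →
               (M : Γ ⊢c τ) → renC r (subC s M) ≡ subC s' M
    ren-subC e (V · W)         = cong₂ _·_ (ren-subV e V) (ren-subV e W)
    ren-subC e (return V)      = cong return (ren-subV e V)
    ren-subC e (lett M P)      = cong₂ lett (ren-subC e M) (ren-subC (liftR-liftS e) P)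
    ren-subC e (fix V)         = cong fix (ren-subV e V)
    ren-subC e (case V M P)    =
      cong-case (ren-subV e V) (ren-subC e M) (ren-subC (liftR-liftS e) P)
    ren-subC e (opFin σ Ms)    = cong (opFin σ) (ren-subCs e Ms)
    ren-subC e (opNFin σ V Ms) = cong₂ (opNFin σ) (ren-subV e V) (ren-subCs e Ms)
    ren-subC e (opInf σ W)     = cong (opInf σ) (ren-subV e W)
    ren-subC e (opNInf σ V W)  = cong₂ (opNInf σ) (ren-subV e V) (ren-subV e W)

    ren-subCs : ∀ {Γ Δ Θ τ n} {s : Sub Γ Δ} {r : Ren Δ Θ} {s' : Sub Γ Θ} →
                (∀ {τ} (x : τ ∈ Γ) → renV r (s x) ≡ s' x) →
                (Ms : Vec (Γ ⊢c τ) n) → renCs r (subCs s Ms) ≡ subCs s' Ms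
    ren-subCs e []       = refl
    ren-subCs e (M ∷ Ms) = cong₂ _∷_ (ren-subC e M) (ren-subCs e Ms)

  liftS-liftS : ∀ {Γ Δ Θ ρ} {s : Sub Γ Δ} {s' : Sub Δ Θ} {s″ : Sub Γ Θ} →
                (∀ {τ} (x : τ ∈ Γ) → subV s' (s x) ≡ s″ x) →
                ∀ {τ} (x : τ ∈ ρ ∷ Γ) → subV (liftS s') (liftS s x) ≡ liftS s″ x
  liftS-liftS e (here _)          = refl
  liftS-liftS {s = s} e (there x) =
    trans (sub-renV (λ _ → refl) (s x)) (trans (sym (ren-subV (λ _ → refl) (s x))) (cong wk (e x)))

  mutual
    sub-subV : ∀ {Γ Δ Θ τ} {s : Sub Γ Δ} {s' : Sub Δ Θ} {s″ : Sub Γ Θ} →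
               (∀ {τ} (x : τ ∈ Γ) → subV s' (s x) ≡ s″ x) →
               (V : Γ ⊢v τ) → subV s' (subV s V) ≡ subV s″ V
    sub-subV e (var x) = e x
    sub-subV e *       = refl
    sub-subV e Z       = refl
    sub-subV e (S V)   = cong S (sub-subV e V)
    sub-subV e (ƛ M)   = cong ƛ (sub-subC (liftS-liftS e) M)

    sub-subC : ∀ {Γ Δ Θ τ} {s : Sub Γ Δ} {s' : Sub Δ Θ} {s″ : Sub Γ Θ} →
               (∀ {τ} (x : τ ∈ Γ) → subV s' (s x) ≡ s″ x) →
               (M : Γ ⊢c τ) → subC s' (subC s M) ≡ subC s″ M
    sub-subC e (V · W)         = cong₂ _·_ (sub-subV e V) (sub-subV e W)
    sub-subC e (return V)      = cong return (sub-subV e V)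
    sub-subC e (lett M P)      = cong₂ lett (sub-subC e M) (sub-subC (liftS-liftS e) P)
    sub-subC e (fix V)         = cong fix (sub-subV e V)
    sub-subC e (case V M P)    =
      cong-case (sub-subV e V) (sub-subC e M) (sub-subC (liftS-liftS e) P)
    sub-subC e (opFin σ Ms)    = cong (opFin σ) (sub-subCs e Ms)
    sub-subC e (opNFin σ V Ms) = cong₂ (opNFin σ) (sub-subV e V) (sub-subCs e Ms)
    sub-subC e (opInf σ W)     = cong (opInf σ) (sub-subV e W)
    sub-subC e (opNInf σ V W)  = cong₂ (opNInf σ) (sub-subV e V) (sub-subV e W)

    sub-subCs : ∀ {Γ Δ Θ τ n} {s : Sub Γ Δ} {s' : Sub Δ Θ} {s″ : Sub Γ Θ} →
                (∀ {τ} (x : τ ∈ Γ) → subV s' (s x) ≡ s″ x) →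
                (Ms : Vec (Γ ⊢c τ) n) → subCs s' (subCs s Ms) ≡ subCs s″ Ms
    sub-subCs e []       = refl
    sub-subCs e (M ∷ Ms) = cong₂ _∷_ (sub-subC e M) (sub-subCs e Ms)

-- Positions in trees, bind, and finite approximation of effect trees.

module Trees (Op : Signature) where
  open Language Op
  open Syntax Op using (unfold)

  -- Hides which proof of definedness is used and makes the label an index, so that leaf and node
  -- can be told apart by matching.
  record At {c} {X : Set c} (t : T X) (p : Path) (l : X ⊎ Node) : Set c where
    constructor at
    field
      defined  : Defined t p
      labelled : label t defined ≡ l

  infix 4 _⊑_

  _⊑_ : ∀ {c} {X : Set c} → T X → T X → Set c
  t ⊑ t' = ∀ {p l} → At t p l → At t' p l

  at-root : ∀ {c} {X : Set c} (t : T X) p → Defined t p → Defined t []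
  at-root t []      d = d
  at-root t (x ∷ p) d = proj₁ (parent t [] (at-root (subtree x t) p d))

  module _ {c} {X : Set c} {P : Pred X 0ℓ} {t : T X} where

    at-restrict : ∀ {p l} → At t p l → Keep P l → At (t [∈ P ]) p (forget P l)
    at-restrict (at d refl) k = at (d , k) refl

    -- Testing erases leaf values, so the two trees may have leaves of different types.
    restrict-≤ : ∀ {c'} {X' : Set c'} {Q : Pred X' 0ℓ} {t' : T X'} →
                 (∀ {p} l → At t p l → Keep P l → At (t' [∈ Q ]) p (forget P l)) →
                 t [∈ P ] ≤ t' [∈ Q ]
    restrict-≤ h (d , k) with h _ (at d refl) k
    ... | at d' e = d' , sym e

  restrict-⊑ : ∀ {c} {X : Set c} {P Q : Pred X 0ℓ} {t t' : T X} →
               t ⊑ t' → (∀ {x} → P x → Q x) → t [∈ P ] ≤ t' [∈ Q ]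
  restrict-⊑ {P = P} {Q} i f = restrict-≤ {P = P} {Q = Q} λ where
    (inj₁ x) a k → at-restrict (i a) (f k)
    (inj₂ ν) a k → at-restrict (i a) tt

  forget-⊤ : ∀ (P : Pred ⊤ 0ℓ) (l : ⊤ ⊎ Node) → forget P l ≡ l
  forget-⊤ P (inj₁ _) = refl
  forget-⊤ P (inj₂ _) = refl

  module _ {X : Set} (L : Path → X ⊎ Node → Set)
           (L-unique : ∀ {p l l'} → L p l → L p l' → l ≡ l')
           (L-parent : ∀ p {ν} {i : Branch ν} {l} → L (p ∷ʳ (ν , i)) l → L p (inj₂ ν)) where

    graph : T X
    graph .Defined p               = ∃[ l ] L p l
    graph .label                   = proj₁
    graph .unique (_ , h) (_ , h') = L-unique h h'
    graph .parent p (_ , h)        = (_ , L-parent p h) , refl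

  ⊥T : ∀ {X : Set} → T X
  ⊥T = graph (λ _ _ → ⊥) (λ ()) (λ _ ())

  data LeafAt {X : Set} (x : X) : Path → X ⊎ Node → Set where
    leaf : LeafAt x [] (inj₁ x)

  leafT : ∀ {X : Set} → X → T X
  leafT x = graph (LeafAt x) (λ { leaf leaf → refl }) λ where
    []      ()
    (_ ∷ _) ()

  data NodeAt (ν : Node) : Path → Branch ν ⊎ Node → Set where
    root  : NodeAt ν [] (inj₂ ν)
    child : ∀ i → NodeAt ν ((ν , i) ∷ []) (inj₁ i)

  -- The generic effect of `ν`: each branch is a leaf carrying its own index. Operations thereby
  -- become binds, and the lemma on binds covers them too.
  nodeT : ∀ ν → T (Branch ν)
  nodeT ν = graph (NodeAt ν) unique-at λ where
      []          (child _) → root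
      (_ ∷ [])    ()
      (_ ∷ _ ∷ _) ()
    where
    unique-at : ∀ {p l l'} → NodeAt ν p l → NodeAt ν p l' → l ≡ l'
    unique-at root      root       = refl
    unique-at (child i) (child .i) = refl

  mapT : ∀ {c c'} {X : Set c} {Y : Set c'} → (X → Y) → T X → T Y
  mapT f t .Defined     = Defined t
  mapT f t .label d     = map₁ f (label t d)
  mapT f t .unique d d' = cong (map₁ f) (unique t d d')
  mapT f t .parent p d  = proj₁ (parent t p d) , cong (map₁ f) (proj₂ (parent t p d))

  -- Opaque so that Agda can recover t and f from bind t f.
  opaque
    bind : ∀ {c} {X : Set} {Y : Set c} → T X → (X → T Y) → T Y
    bind t f = μ (mapT f t)

    bind-≡μ : ∀ {c} {X : Set} {Y : Set c} (t : T X) (f : X → T Y) → bind t f ≡ μ (mapT f t)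
    bind-≡μ t f = refl

  module _ {c} {X : Set} {Y : Set c} {f : X → T Y} where

    -- The positions of a flattened tree without the path recursion of `μ`: an internal node of `t`,
    -- or a path to a leaf continued in the tree grafted there.
    data Bind (t : T X) : Path → Y ⊎ Node → Set c where
      inner : ∀ {p ν} → At t p (inj₂ ν) → Bind t p (inj₂ ν)
      outer : ∀ {p q l x} → At t p (inj₁ x) → At (f x) q l → Bind t (p ++ q) l

    -- The root label `y` is kept as a variable so that an equation for it can be transported by
    -- `subst`.
    Below : T X → X ⊎ Node → Path → Y ⊎ Node → Set c
    Below t y p l = Σ[ b ∈ μBelow (mapT f t) (map₁ f y) p ]
                      μLabelBelow (mapT f t) (map₁ f y) p b ≡ l

    opaque
      unfolding bind

      mutual
        bind⁻ : ∀ {t p l} → At (bind t f) p l → Bind t p l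
        bind⁻ {t} {p} (at (d , b) e) = bindBelow⁻ p d (label t d) refl b e

        bindBelow⁻ : ∀ {t} p {l} (d : Defined t []) y → label t d ≡ y →
                     (b : μBelow (mapT f t) (map₁ f y) p) →
                     μLabelBelow (mapT f t) (map₁ f y) p b ≡ l → Bind t p l
        bindBelow⁻     p       d (inj₁ x) d≡ b e    = outer (at d d≡) (at b e)
        bindBelow⁻     []      d (inj₂ ν) d≡ b refl = inner (at d d≡)
        bindBelow⁻ {t} (x ∷ p) d (inj₂ ν) d≡ b e with bind⁻ {subtree x t} {p} (at b e)
        ... | inner (at d' e')   = inner (at d' e')
        ... | outer (at d' e') a = outer (at d' e') a

      bind-here : ∀ {t p l} (d : Defined t []) → Below t (label t d) p l → At (bind t f) p l
      bind-here d (b , e) = at (d , b) e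

      bind-there : ∀ {t} x p q {l} → Defined t (x ∷ p) → At (bind (subtree x t) f) q l →
                   At (bind t f) (x ∷ q) l
      -- `μ` descends only below a root known to be an internal node; prefix closure of `t` supplies
      -- that label.
      bind-there {t} x p q {l} d (at b e') with parent t [] (at-root (subtree x t) p d)
      ... | d₀ , e = bind-here {t} d₀ (subst (λ y → Below t y (x ∷ q) l) (sym e) (b , e'))

      bind-inner : ∀ {t} p {ν} → At t p (inj₂ ν) → At (bind t f) p (inj₂ ν)
      bind-inner {t} []      (at d e) =
        bind-here {t} d (subst (λ y → Below t y [] (inj₂ _)) (sym e) (tt , refl))
      bind-inner {t} (x ∷ p) (at d e) =
        bind-there {t} x p p d (bind-inner {subtree x t} p (at d e))

      bind-outer : ∀ {t} p {q l x} → At t p (inj₁ x) → At (f x) q l → At (bind t f) (p ++ q) l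
      bind-outer {t} [] {q} {l} (at d e) (at b e') =
        bind-here {t} d (subst (λ y → Below t y q l) (sym e) (b , e'))
      bind-outer {t} (x ∷ p) (at d e) a =
        bind-there {t} x p _ d (bind-outer {subtree x t} p (at d e) a)

      bind⁺ : ∀ {t p l} → Bind t p l → At (bind t f) p l
      bind⁺ {t} (inner a)   = bind-inner {t} _ a
      bind⁺ {t} (outer a h) = bind-outer {t} _ a h

  bind-mono : ∀ {c} {X : Set} {Y : Set c} {t t' : T X} {f f' : X → T Y} →
              t ⊑ t' → (∀ x → f x ⊑ f' x) → bind t f ⊑ bind t' f'
  bind-mono {t = t} {f = f} i j a with bind⁻ {f = f} {t} a
  ... | inner b   = bind⁺ (inner (i b))
  ... | outer b h = bind⁺ (outer (i b) (j _ h))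

  -- Regroups sequencing under the branches of a node as sequencing after the whole node.
  bind-assoc : ∀ {X Y W : Set} {t : T X} {f : X → T Y} {g : Y → T W} →
               bind t (λ x → bind (f x) g) ⊑ bind (bind t f) g
  bind-assoc {t = t} {f} {g} a with bind⁻ a
  ... | inner b                 = bind⁺ (inner (bind⁺ (inner b)))
  ... | outer {p} b h with bind⁻ h
  ...   | inner k               = bind⁺ (inner (bind⁺ (outer b k)))
  ...   | outer {q} {q'} {l} k m =
    subst (λ p → At (bind (bind t f) g) p l) (++-assoc p q q')
      (bind⁺ (outer (bind⁺ (outer b k)) m))

  -- Both halves of a sequencing receive the same remaining fuel, so fuel bounds the height of a
  -- big-step evaluation rather than a number of steps.
  approx : ∀ {τ} → ℕ → Com τ → T (Val τ)
  approx zero    M                = ⊥T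
  approx (suc n) (ƛ M · V)        = approx n (M [ V ])
  approx (suc n) (return V)       = leafT V
  approx (suc n) (lett M P)       = bind (approx n M) (λ V → approx n (P [ V ]))
  approx (suc n) (fix F)          = approx n (unfold F)
  approx (suc n) (case Z M P)     = approx n M
  approx (suc n) (case (S V) M P) = approx n (P [ V ])
  approx (suc n) (opFin σ Ms)     = bind (nodeT (node σ tt)) (λ i → approx n (lookup Ms i))
  approx (suc n) (opNFin σ V Ms)  = bind (nodeT (node σ (toℕ V))) (λ i → approx n (lookup Ms i))
  approx (suc n) (opInf σ W)      = bind (nodeT (node σ tt)) (λ m → approx n (W · numeral m))
  approx (suc n) (opNInf σ V W)   = bind (nodeT (node σ (toℕ V))) (λ m → approx n (W · numeral m))

  approx-suc : ∀ {τ} n (M : Com τ) → approx n M ⊑ approx (suc n) M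
  approx-suc (suc n) (ƛ M · V)        a = approx-suc n (M [ V ]) a
  approx-suc (suc n) (return V)       a = a
  approx-suc (suc n) (lett M P)       a =
    bind-mono (approx-suc n M) (λ V → approx-suc n (P [ V ])) a
  approx-suc (suc n) (fix F)          a = approx-suc n (unfold F) a
  approx-suc (suc n) (case Z M P)     a = approx-suc n M a
  approx-suc (suc n) (case (S V) M P) a = approx-suc n (P [ V ]) a
  approx-suc (suc n) (opFin σ Ms)     a =
    bind-mono (λ b → b) (λ i → approx-suc n (lookup Ms i)) a
  approx-suc (suc n) (opNFin σ V Ms)  a =
    bind-mono (λ b → b) (λ i → approx-suc n (lookup Ms i)) a
  approx-suc (suc n) (opInf σ W)      a =
    bind-mono (λ b → b) (λ m → approx-suc n (W · numeral m)) a
  approx-suc (suc n) (opNInf σ V W)   a =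
    bind-mono (λ b → b) (λ m → approx-suc n (W · numeral m)) a

  approx-≤′ : ∀ {τ m n} (M : Com τ) → m ≤′ n → approx m M ⊑ approx n M
  approx-≤′ M ≤′-refl           a = a
  approx-≤′ M (≤′-step {n} m≤n) a = approx-suc n M (approx-≤′ M m≤n a)

  ⇓-let-node : ∀ {ρ τ} {M : Com ρ} {P : ρ ∷ [] ⊢c τ} {p ν} →
               M at p ⇓ inj₂ ν → lett M P at p ⇓ inj₂ ν
  ⇓-let-node {P = P} (stepping e h) = stepping (cong (λ s → stepLet s P) e) (⇓-let-node h)
  ⇓-let-node {P = P} (root e)       = root (cong (λ s → stepLet s P) e)
  ⇓-let-node {P = P} (child e h)    = child (cong (λ s → stepLet s P) e) (⇓-let-node h)

  ⇓-let-leaf : ∀ {ρ τ} {M : Com ρ} {P : ρ ∷ [] ⊢c τ} {p q V l} →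
               M at p ⇓ inj₁ V → P [ V ] at q ⇓ l → lett M P at p ++ q ⇓ l
  ⇓-let-leaf {P = P} (stepping e h) k = stepping (cong (λ s → stepLet s P) e) (⇓-let-leaf h k)
  ⇓-let-leaf {P = P} (leaf e)       k = stepping (cong (λ s → stepLet s P) e) k
  ⇓-let-leaf {P = P} (child e h)    k = child (cong (λ s → stepLet s P) e) (⇓-let-leaf h k)

  bind-⊑-let : ∀ {ρ τ} (M : Com ρ) (P : ρ ∷ [] ⊢c τ) →
               bind ∣ M ∣ (λ V → ∣ P [ V ] ∣) ⊑ ∣ lett M P ∣
  bind-⊑-let M P a with bind⁻ {t = ∣ M ∣} a
  ... | inner (at (_ , h) refl)                   = at (_ , ⇓-let-node h) refl
  ... | outer (at (_ , h) refl) (at (_ , k) refl) = at (_ , ⇓-let-leaf h k) refl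

  bind-⊑-op : ∀ {τ} {M : Com τ} {ν k} → step M ≡ op ν k →
              bind (nodeT ν) (λ i → ∣ k i ∣) ⊑ ∣ M ∣
  bind-⊑-op {ν = ν} e a with bind⁻ {t = nodeT ν} a
  ... | inner (at (_ , root) refl)                      = at (_ , root e) refl
  ... | outer (at (_ , child i) refl) (at (_ , h) refl) = at (_ , child e h) refl

  ⊑-next : ∀ {τ} {M M' : Com τ} → step M ≡ next M' → ∣ M' ∣ ⊑ ∣ M ∣
  ⊑-next e (at (_ , h) e') = at (_ , stepping e h) e'

  approx-sound : ∀ {τ} n (M : Com τ) → approx n M ⊑ ∣ M ∣
  approx-sound (suc n) (ƛ M · V)        a = ⊑-next refl (approx-sound n (M [ V ]) a)
  approx-sound (suc n) (return V)       (at (_ , leaf) refl) = at (_ , leaf refl) refl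
  approx-sound (suc n) (lett M P)       a =
    bind-⊑-let M P (bind-mono (approx-sound n M) (λ V → approx-sound n (P [ V ])) a)
  approx-sound (suc n) (fix F)          a = ⊑-next refl (approx-sound n (unfold F) a)
  approx-sound (suc n) (case Z M P)     a = ⊑-next refl (approx-sound n M a)
  approx-sound (suc n) (case (S V) M P) a = ⊑-next refl (approx-sound n (P [ V ]) a)
  approx-sound (suc n) (opFin σ Ms)     a =
    bind-⊑-op refl (bind-mono (λ b → b) (λ i → approx-sound n (lookup Ms i)) a)
  approx-sound (suc n) (opNFin σ V Ms)  a =
    bind-⊑-op refl (bind-mono (λ b → b) (λ i → approx-sound n (lookup Ms i)) a)
  approx-sound (suc n) (opInf σ W)      a =
    bind-⊑-op refl (bind-mono (λ b → b) (λ m → approx-sound n (W · numeral m)) a)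
  approx-sound (suc n) (opNInf σ V W)   a =
    bind-⊑-op refl (bind-mono (λ b → b) (λ m → approx-sound n (W · numeral m)) a)

  Approx : ∀ {τ} → Com τ → Path → Val τ ⊎ Node → Set
  Approx M p l = ∃[ n ] At (approx n M) p l

  -- The bridge to small steps: perform one step exactly, then approximate whatever computations
  -- remain.
  approxStep : ∀ {τ} → ℕ → Step τ → T (Val τ)
  approxStep n (next M) = approx n M
  approxStep n (val V)  = leafT V
  approxStep n (op ν k) = bind (nodeT ν) (λ i → approx n (k i))

  -- A position of the bind involves one position of `t` and at most one of a continuation. The
  -- larger of their two fuels serves both, even if no single fuel serves all of `t`; one more unit
  -- pays for the `lett`.
  approx-let : ∀ {ρ τ} {t : T (Val ρ)} n (M : Com ρ) (P : ρ ∷ [] ⊢c τ) →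
               (∀ {p l} → At t p l → Approx M p l) →
               ∀ {p l} → At (bind t (λ V → approx n (P [ V ]))) p l → Approx (lett M P) p l
  approx-let {t = t} n M P f a with bind⁻ a
  ... | inner b   = let m , c = f b in suc m , bind⁺ (inner c)
  ... | outer {x = V} b h = let m , c = f b in
    suc (m ⊔ n) , bind⁺ (outer (approx-≤′ M (≤⇒≤′ (m≤m⊔n m n)) c)
                               (approx-≤′ (P [ V ]) (≤⇒≤′ (m≤n⊔m m n)) h))

  approx-step : ∀ {τ} n (M : Com τ) {p l} → At (approxStep n (step M)) p l → Approx M p l
  approx-step n (ƛ M · V)        a = suc n , a
  approx-step n (return V)       a = suc n , a
  -- The induction hypothesis is abstracted together with `step M`, so that the case split also
  -- refines its type.
  approx-step n (lett M P)       a with step M | (λ m {p} {l} → approx-step m M {p} {l})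
  approx-step (suc n) (lett M P) a | next M' | ih = approx-let n M P (ih n) a
  approx-step n       (lett M P) a | val V   | ih =
    approx-let n M P (ih n) (bind⁺ (outer (at (_ , leaf) refl) a))
  approx-step n       (lett M P) a | op ν k  | ih with bind⁻ {t = nodeT ν} a
  ... | inner b = approx-let n M P (ih n) (bind⁺ (inner (bind⁺ (inner b))))
  approx-step (suc n) (lett M P) a | op ν k  | ih | outer b h =
    -- With positive fuel the branch is itself a bind. Reassociation exposes the node with its
    -- approximated branches as the head, which is the tree that `ih` speaks about.
    approx-let n M P (ih n) (bind-assoc {t = nodeT ν} (bind⁺ (outer b h)))
  approx-step n (fix F)          a = suc n , a
  approx-step n (case Z M P)     a = suc n , a
  approx-step n (case (S V) M P) a = suc n , a
  approx-step n (opFin σ Ms)     a = suc n , a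
  approx-step n (opNFin σ V Ms)  a = suc n , a
  approx-step n (opInf σ W)      a = suc n , a
  approx-step n (opNInf σ V W)   a = suc n , a

  approx-complete : ∀ {τ} {M : Com τ} {p l} → M at p ⇓ l → Approx M p l
  approx-complete {M = M} {p} {l} (stepping e h) =
    let n , a = approx-complete h
    in approx-step n M (subst (λ s → At (approxStep n s) p l) (sym e) a)
  approx-complete {M = M} {p} {l} (leaf e) =
    -- Fuel 0 is enough for a label at the root: no computation remains to be approximated, and
    -- `approx-step` adds the fuel that `M` itself costs.
    approx-step 0 M (subst (λ s → At (approxStep 0 s) p l) (sym e) (at (_ , leaf) refl))
  approx-complete {M = M} {p} {l} (root e) =
    approx-step 0 M (subst (λ s → At (approxStep 0 s) p l) (sym e)
                       (bind⁺ (inner (at (_ , root) refl))))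
  approx-complete {M = M} {p} {l} (child e h) =
    let n , a = approx-complete h
    in approx-step n M (subst (λ s → At (approxStep n s) p l) (sym e)
                         (bind⁺ (outer (at (_ , child _) refl) a)))

  -- Leastness is checked position by position, and each position has its final label at some finite
  -- fuel.
  approx-sup : ∀ {τ} (M : Com τ) (A : Pred (Val τ) 0ℓ) →
               IsSup (λ n → approx n M [∈ A ]) (∣ M ∣ [∈ A ])
  approx-sup M A .proj₁ n = restrict-⊑ {P = A} (approx-sound n M) (λ a → a)
  approx-sup M A .proj₂ u h ((_ , e) , k) with approx-complete e
  ... | n , at d refl = h n (d , k)

-- Relation lifting along the modalities and its closure under bind.

module Lifting (Op : Signature) {O : Set} (⟦_⟧ : O → Pred (Language.T Op ⊤) 0ℓ)
               (open-⟦⟧ : ∀ o → Language.ScottOpen Op ⟦ o ⟧) where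
  open Language Op
  open Modalities ⟦_⟧
  open Trees Op

  Lift-⊑ : ∀ {X : Set} {R Q : Rel X 0ℓ} {t t' t″ : T X} →
           (∀ {x y} → R x y → Q x y) → t' ⊑ t″ → Lift R t t' → Lift Q t t″
  Lift-⊑ {R = R} {t' = t'} {t″} f i l A o m =
    upward (open-⟦⟧ o)
      (restrict-⊑ {P = Image R A} {t = t'} {t″} i (λ (x , a , h) → x , a , f h))
      (l A o m)

  Lift-refl : ∀ {X : Set} {R : Rel X 0ℓ} {t : T X} → (∀ {x} → R x x) → Lift R t t
  Lift-refl {R = R} {t} r A o m =
    upward (open-⟦⟧ o) (restrict-mono {P = A} {Image R A} t (λ a → _ , a , r)) m

  Lift-trans : ∀ {X : Set} {R Q Q' : Rel X 0ℓ} {t t' t″ : T X} →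
               (∀ {x y z} → R x y → Q y z → Q' x z) → Lift R t t' → Lift Q t' t″ → Lift Q' t t″
  Lift-trans {R = R} {Q} {Q'} {t″ = t″} f l l' A o m =
    upward (open-⟦⟧ o)
      (restrict-mono {P = Image Q (Image R A)} {Image Q' A} t″
        (λ (y , (x , a , h) , k) → x , a , f h k))
      -- The predicate left implicit is `Image R A`, which the first lifting delivers.
      (l' _ o (l A o m))

  Lift-leaf : ∀ {X : Set} {R : Rel X 0ℓ} {x y} → R x y → Lift R (leafT x) (leafT y)
  Lift-leaf {R = R} {x} {y} r A o m = upward (open-⟦⟧ o) (restrict-≤ {P = A} leaf-≤) m
    where
    leaf-≤ : ∀ {p} l → At (leafT x) p l → Keep A l → At (leafT y [∈ Image R A ]) p (forget A l)
    leaf-≤ (inj₁ _) (at (_ , leaf) refl) k = at-restrict (at (_ , leaf) refl) (_ , k , r)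

  -- After the first test every leaf is `tt`, so a second test adds the constant condition `Q tt`.
  restrict-restrict-≤ : ∀ {X : Set} (t : T X) (P : Pred X 0ℓ) (Q : Pred ⊤ 0ℓ) →
                        (t [∈ P ]) [∈ Q ] ≤ t [∈ (λ x → P x × Q tt) ]
  restrict-restrict-≤ t P Q ((d , k) , k') with label t d in e
  ... | inj₁ x = (d , subst (Keep (λ x → P x × Q tt)) (sym e) (k , k')) ,
                 sym (cong (forget (λ x → P x × Q tt)) e)
  ... | inj₂ ν = (d , subst (Keep (λ x → P x × Q tt)) (sym e) tt) ,
                 sym (cong (forget (λ x → P x × Q tt)) e)

  ≤-restrict-restrict : ∀ {X : Set} (t : T X) (P : Pred X 0ℓ) (Q : Pred ⊤ 0ℓ) →
                        t [∈ (λ x → P x × Q tt) ] ≤ (t [∈ P ]) [∈ Q ]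
  ≤-restrict-restrict t P Q = restrict-≤ {P = λ x → P x × Q tt} {t} {Q = Q} λ where
    (inj₁ x) a (k , k') → at-restrict {P = Q} (at-restrict {P = P} a k) k'
    (inj₂ ν) a _        → at-restrict {P = Q} (at-restrict {P = P} a tt) tt

  -- A basic formula tests with a predicate on `⊤`; merged with `A` it becomes one test of `t`, to
  -- which the lifting applies. Joins and meets follow by induction on formulas.
  Lift-⊴ : ∀ {X : Set} {R : Rel X 0ℓ} {t t' : T X} → Lift R t t' →
           ∀ A → t [∈ A ] ⊴ t' [∈ Image R A ]
  Lift-⊴ {X} {R} {t} {t'} l A = go
    where
    go-o : ∀ o (Q : Pred ⊤ 0ℓ) → (o ⟨ Q ⟩) (t [∈ A ]) → (o ⟨ Q ⟩) (t' [∈ Image R A ])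
    go-o o Q m =
      upward (open-⟦⟧ o) {t' [∈ (λ y → Image R A y × Q tt) ]}
        (≤-restrict-restrict t' (Image R A) Q)
        (upward (open-⟦⟧ o)
          (restrict-mono {P = Image R (λ x → A x × Q tt)} {λ y → Image R A y × Q tt} t'
            (λ (x , (a , q) , h) → (x , a , h) , q))
          (l _ o (upward (open-⟦⟧ o) (restrict-restrict-≤ t A Q) m)))

    go : t [∈ A ] ⊴ t' [∈ Image R A ]
    go (o ⊤′)  m       = go-o o _ m
    go (o ⊥′)  m       = go-o o _ m
    go (⋁ I Φ) (i , m) = i , go (Φ i) m
    go (⋀ I Φ) m       = λ i → go (Φ i) (m i)

  -- Used at `Y = T ⊤`, which lives one universe up, hence the level of `Y`. Trees are compared by
  -- `≤` in both directions rather than by equality.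
  restrict-mapT-≤ : ∀ {X : Set} {c} {Y : Set c} (t : T X) {f : X → Y} (P : Pred Y 0ℓ) →
                    mapT f t [∈ P ] ≤ t [∈ (λ x → P (f x)) ]
  restrict-mapT-≤ t {f} P (d , k) with label t d in e
  ... | inj₁ x = (d , subst (Keep (λ x → P (f x))) (sym e) k) ,
                 sym (cong (forget (λ x → P (f x))) e)
  ... | inj₂ ν = (d , subst (Keep (λ x → P (f x))) (sym e) tt) ,
                 sym (cong (forget (λ x → P (f x))) e)

  ≤-restrict-mapT : ∀ {X : Set} {c} {Y : Set c} (t : T X) {f : X → Y} (P : Pred Y 0ℓ) →
                    t [∈ (λ x → P (f x)) ] ≤ mapT f t [∈ P ]
  ≤-restrict-mapT t P (d , k) with label t d in e
  ... | inj₁ x = (d , subst (λ l → Keep P (map₁ _ l)) (sym e) k) ,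
                 sym (cong (λ l → forget P (map₁ _ l)) e)
  ... | inj₂ ν = (d , subst (λ l → Keep P (map₁ _ l)) (sym e) tt) ,
                 sym (cong (λ l → forget P (map₁ _ l)) e)

  always : Pred ⊤ 0ℓ
  always _ = ⊤

  keep-always : ∀ l → Keep always l
  keep-always (inj₁ _) = tt
  keep-always (inj₂ _) = tt

  module _ {X Y : Set} {t : T X} {f : X → T Y} {A : Pred Y 0ℓ} where

    -- Moves the test from the flattened tree into the continuations. The remaining test `always`
    -- puts the result in the form of a basic formula `o ⊤′`.
    restrict-bind-≤ : bind t f [∈ A ] ≤ bind t (λ x → f x [∈ A ]) [∈ always ]
    restrict-bind-≤ = restrict-≤ {P = A} λ l a k → go l (bind⁻ a) k
      where
      at-always : ∀ {s : T ⊤} {p l} → At s p l → At (s [∈ always ]) p l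
      at-always {s} {p} {l} a =
        subst (At (s [∈ always ]) p) (forget-⊤ always l) (at-restrict a (keep-always l))

      go : ∀ {p} l → Bind t p l → Keep A l →
           At (bind t (λ x → f x [∈ A ]) [∈ always ]) p (forget A l)
      go l (inner a)   k = at-always (bind⁺ (inner a))
      go l (outer a h) k = at-always (bind⁺ (outer a (at-restrict h k)))

    ≤-restrict-bind : bind t (λ x → f x [∈ A ]) [∈ always ] ≤ bind t f [∈ A ]
    ≤-restrict-bind = restrict-≤ {P = always} λ l a _ →
        subst (At (bind t f [∈ A ]) _) (sym (forget-⊤ always l)) (go (bind⁻ a))
      where
      go : ∀ {p l} → Bind t p l → At (bind t f [∈ A ]) p l
      go (inner a)                   = at-restrict (bind⁺ (inner a)) tt
      go (outer a (at (d , k) refl)) = at-restrict (bind⁺ (outer a (at d refl))) k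

  -- The only use of decomposability, at trees of trees obtained by testing the
  -- continuations f x and f' y with A and R[A].
  Lift-bind : Decomposable → ∀ {X Y : Set} {Q : Rel X 0ℓ} {R : Rel Y 0ℓ} {t t' : T X}
              {f f' : X → T Y} → Lift Q t t' → (∀ {x y} → Q x y → Lift R (f x) (f' y)) →
              Lift R (bind t f) (bind t' f')
  Lift-bind dec {X} {Y} {Q} {R} {t} {t'} {f} {f'} l h A o m =
    upward (open-⟦⟧ o) ≤-restrict-bind
      (subst (λ s → ⟦ o ⟧ (s [∈ always ])) (sym (bind-≡μ t' _))
        (dec r≼r' (o ⊤′)
          (subst (λ s → ⟦ o ⟧ (s [∈ always ])) (bind-≡μ t _)
            (upward (open-⟦⟧ o) restrict-bind-≤ m))))
    where
    r r' : T (T ⊤)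
    r  = mapT (λ x → f x [∈ A ]) t
    r' = mapT (λ x → f' x [∈ Image R A ]) t'

    r≼r' : r ≼ r'
    -- Testing `r` with `Φ` amounts to testing `t` for those `x` whose tested continuation satisfies
    -- `Φ`. The lifting carries this to the `Q`-image, and `Lift-⊴` on related continuations shows
    -- that `Φ` holds there too.
    r≼r' o Φ m =
      upward (open-⟦⟧ o) {t' [∈ (λ y → ⟦ Φ ⟧𝒯 (f' y [∈ Image R A ])) ]} (≤-restrict-mapT t' ⟦ Φ ⟧𝒯)
        (upward (open-⟦⟧ o)
          (restrict-mono {P = Image Q (λ x → ⟦ Φ ⟧𝒯 (f x [∈ A ]))}
            {λ y → ⟦ Φ ⟧𝒯 (f' y [∈ Image R A ])} t'
            (λ (x , a , q) → Lift-⊴ (h q) A Φ a))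
          (l _ o (upward (open-⟦⟧ o) (restrict-mapT-≤ t ⟦ Φ ⟧𝒯) m)))

-- Identity and composition of typed relations.

module Relations (Op : Signature) where
  open Language Op

  identity : TypedRel
  identity .onVal = _≡_
  identity .onCom = _≡_

  infixr 9 _⨾_

  _⨾_ : TypedRel → TypedRel → TypedRel
  (R ⨾ Q) .onVal V U = ∃[ W ] onVal R V W × onVal Q W U
  (R ⨾ Q) .onCom M L = ∃[ P ] onCom R M P × onCom Q P L

  Reflexive Transitive : TypedRel → Set
  Reflexive R  = identity ⊆ R
  Transitive R = R ⨾ R ⊆ R

-- The Howe closure of a preorder: substitutivity, reversal and compatibility.

module HoweClosure (Op : Signature) (R : Language.TypedRel Op)
                   (R-refl : Relations.Reflexive Op R)
                   (R-trans : Relations.Transitive Op R) where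
  open Language Op
  open Syntax Op

  infix 4 _⊢_≈v_ _⊢_≈c_ _⊢_≲v_ _⊢_≲c_ _⊢_≲cs_

  -- Records rather than synonyms for R °, whose two terms Agda could not infer.
  record _⊢_≈v_ (Γ : Ctx) {τ} (V W : Γ ⊢v τ) : Set where
    constructor instV
    field atV : onVal° (R °) Γ V W

  record _⊢_≈c_ (Γ : Ctx) {τ} (M P : Γ ⊢c τ) : Set where
    constructor instC
    field atC : onCom° (R °) Γ M P

  open _⊢_≈v_
  open _⊢_≈c_

  ≈v-sub : ∀ {Γ Δ τ} {V W : Γ ⊢v τ} (s : Sub Γ Δ) → Γ ⊢ V ≈v W → Δ ⊢ subV s V ≈v subV s W
  ≈v-sub {V = V} {W} s b .atV s' =
    subst₂ (onVal R) (sym (sub-subV (λ _ → refl) V)) (sym (sub-subV (λ _ → refl) W))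
      (atV b (λ x → subV s' (s x)))

  ≈c-sub : ∀ {Γ Δ τ} {M P : Γ ⊢c τ} (s : Sub Γ Δ) → Γ ⊢ M ≈c P → Δ ⊢ subC s M ≈c subC s P
  ≈c-sub {M = M} {P} s b .atC s' =
    subst₂ (onCom R) (sym (sub-subC (λ _ → refl) M)) (sym (sub-subC (λ _ → refl) P))
      (atC b (λ x → subV s' (s x)))

  ≈v-ren : ∀ {Γ Δ τ} {V W : Γ ⊢v τ} (r : Ren Γ Δ) → Γ ⊢ V ≈v W → Δ ⊢ renV r V ≈v renV r W
  ≈v-ren {V = V} {W} r b .atV s =
    subst₂ (onVal R) (sym (sub-renV (λ _ → refl) V)) (sym (sub-renV (λ _ → refl) W))
      (atV b (λ x → s (r x)))

  ≈c-ren : ∀ {Γ Δ τ} {M P : Γ ⊢c τ} (r : Ren Γ Δ) → Γ ⊢ M ≈c P → Δ ⊢ renC r M ≈c renC r P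
  ≈c-ren {M = M} {P} r b .atC s =
    subst₂ (onCom R) (sym (sub-renC (λ _ → refl) M)) (sym (sub-renC (λ _ → refl) P))
      (atC b (λ x → s (r x)))

  -- A substitution out of the empty context acts as the identity only up to a proved equation, so
  -- closed terms need this passage.
  ≈v-open : ∀ {τ} {V W : Val τ} → onVal R V W → [] ⊢ V ≈v W
  ≈v-open {V = V} {W} b .atV s =
    subst₂ (onVal R) (sym (sub-idV (λ ()) V)) (sym (sub-idV (λ ()) W)) b

  ≈c-open : ∀ {τ} {M P : Com τ} → onCom R M P → [] ⊢ M ≈c P
  ≈c-open {M = M} {P} b .atC s =
    subst₂ (onCom R) (sym (sub-idC (λ ()) M)) (sym (sub-idC (λ ()) P)) b

  ≈v-close : ∀ {τ} {V W : Val τ} → [] ⊢ V ≈v W → onVal R V W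
  ≈v-close {V = V} {W} b = subst₂ (onVal R) (sub-idV (λ ()) V) (sub-idV (λ ()) W) (atV b var)

  ≈c-close : ∀ {τ} {M P : Com τ} → [] ⊢ M ≈c P → onCom R M P
  ≈c-close {M = M} {P} b = subst₂ (onCom R) (sub-idC (λ ()) M) (sub-idC (λ ()) P) (atC b var)

  ≈v-refl : ∀ {Γ τ} {V : Γ ⊢v τ} → Γ ⊢ V ≈v V
  ≈v-refl .atV s = proj₁ R-refl refl

  ≈c-refl : ∀ {Γ τ} {M : Γ ⊢c τ} → Γ ⊢ M ≈c M
  ≈c-refl .atC s = proj₂ R-refl refl

  ≈v-trans : ∀ {Γ τ} {V W U : Γ ⊢v τ} → Γ ⊢ V ≈v W → Γ ⊢ W ≈v U → Γ ⊢ V ≈v U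
  ≈v-trans b b' .atV s = proj₁ R-trans (_ , atV b s , atV b' s)

  ≈c-trans : ∀ {Γ τ} {M P Q : Γ ⊢c τ} → Γ ⊢ M ≈c P → Γ ⊢ P ≈c Q → Γ ⊢ M ≈c Q
  ≈c-trans b b' .atC s = proj₂ R-trans (_ , atC b s , atC b' s)

  mutual
    -- A single `≈v` closes each rule in place of a transitivity rule, so the shape of the left term
    -- determines the last rule and inversion is immediate.
    data _⊢_≲v_ (Γ : Ctx) : ∀ {τ} → Γ ⊢v τ → Γ ⊢v τ → Set where
      varʰ : ∀ {τ} {x : τ ∈ Γ} {U} → Γ ⊢ var x ≈v U → Γ ⊢ var x ≲v U
      *ʰ   : ∀ {U} → Γ ⊢ * ≈v U → Γ ⊢ * ≲v U
      Zʰ   : ∀ {U} → Γ ⊢ Z ≈v U → Γ ⊢ Z ≲v U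
      Sʰ   : ∀ {V V' U} → Γ ⊢ V ≲v V' → Γ ⊢ S V' ≈v U → Γ ⊢ S V ≲v U
      ƛʰ   : ∀ {ρ τ} {M M' : ρ ∷ Γ ⊢c τ} {U} →
             ρ ∷ Γ ⊢ M ≲c M' → Γ ⊢ ƛ M' ≈v U → Γ ⊢ ƛ M ≲v U

    data _⊢_≲c_ (Γ : Ctx) : ∀ {τ} → Γ ⊢c τ → Γ ⊢c τ → Set where
      ·ʰ      : ∀ {ρ τ} {V V' : Γ ⊢v ρ ⇒ τ} {W W' Q} → Γ ⊢ V ≲v V' → Γ ⊢ W ≲v W' →
                Γ ⊢ V' · W' ≈c Q → Γ ⊢ V · W ≲c Q
      returnʰ : ∀ {τ} {V V' : Γ ⊢v τ} {Q} → Γ ⊢ V ≲v V' →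
                Γ ⊢ return V' ≈c Q → Γ ⊢ return V ≲c Q
      lettʰ   : ∀ {ρ τ} {M M' : Γ ⊢c ρ} {P P' : ρ ∷ Γ ⊢c τ} {Q} →
                Γ ⊢ M ≲c M' → ρ ∷ Γ ⊢ P ≲c P' →
                Γ ⊢ lett M' P' ≈c Q → Γ ⊢ lett M P ≲c Q
      fixʰ    : ∀ {ρ τ} {V V' : Γ ⊢v (ρ ⇒ τ) ⇒ (ρ ⇒ τ)} {Q} → Γ ⊢ V ≲v V' →
                Γ ⊢ fix V' ≈c Q → Γ ⊢ fix V ≲c Q
      caseʰ   : ∀ {τ V V'} {M M' : Γ ⊢c τ} {P P' Q} →
                Γ ⊢ V ≲v V' → Γ ⊢ M ≲c M' → N ∷ Γ ⊢ P ≲c P' →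
                Γ ⊢ case V' M' P' ≈c Q → Γ ⊢ case V M P ≲c Q
      opFinʰ  : ∀ {τ n} {σ : Op (α^ n)} {Ms Ms' : Vec (Γ ⊢c τ) n} {Q} → Γ ⊢ Ms ≲cs Ms' →
                Γ ⊢ opFin σ Ms' ≈c Q → Γ ⊢ opFin σ Ms ≲c Q
      opNFinʰ : ∀ {τ n} {σ : Op (N×α^ n)} {V V'} {Ms Ms' : Vec (Γ ⊢c τ) n} {Q} →
                Γ ⊢ V ≲v V' → Γ ⊢ Ms ≲cs Ms' →
                Γ ⊢ opNFin σ V' Ms' ≈c Q → Γ ⊢ opNFin σ V Ms ≲c Q
      opInfʰ  : ∀ {τ σ} {W W' : Γ ⊢v N ⇒ τ} {Q} → Γ ⊢ W ≲v W' →
                Γ ⊢ opInf σ W' ≈c Q → Γ ⊢ opInf σ W ≲c Q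
      opNInfʰ : ∀ {τ σ V V'} {W W' : Γ ⊢v N ⇒ τ} {Q} → Γ ⊢ V ≲v V' → Γ ⊢ W ≲v W' →
                Γ ⊢ opNInf σ V' W' ≈c Q → Γ ⊢ opNInf σ V W ≲c Q

    _⊢_≲cs_ : ∀ Γ {τ n} → Rel (Vec (Γ ⊢c τ) n) 0ℓ
    Γ ⊢ Ms ≲cs Ms' = Pointwise (Γ ⊢_≲c_) Ms Ms'

  mutual
    ≲v-refl : ∀ {Γ τ} (V : Γ ⊢v τ) → Γ ⊢ V ≲v V
    ≲v-refl (var x) = varʰ ≈v-refl
    ≲v-refl *       = *ʰ ≈v-refl
    ≲v-refl Z       = Zʰ ≈v-refl
    ≲v-refl (S V)   = Sʰ (≲v-refl V) ≈v-refl
    ≲v-refl (ƛ M)   = ƛʰ (≲c-refl M) ≈v-refl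

    ≲c-refl : ∀ {Γ τ} (M : Γ ⊢c τ) → Γ ⊢ M ≲c M
    ≲c-refl (V · W)         = ·ʰ (≲v-refl V) (≲v-refl W) ≈c-refl
    ≲c-refl (return V)      = returnʰ (≲v-refl V) ≈c-refl
    ≲c-refl (lett M P)      = lettʰ (≲c-refl M) (≲c-refl P) ≈c-refl
    ≲c-refl (fix V)         = fixʰ (≲v-refl V) ≈c-refl
    ≲c-refl (case V M P)    = caseʰ (≲v-refl V) (≲c-refl M) (≲c-refl P) ≈c-refl
    ≲c-refl (opFin σ Ms)    = opFinʰ (≲cs-refl Ms) ≈c-refl
    ≲c-refl (opNFin σ V Ms) = opNFinʰ (≲v-refl V) (≲cs-refl Ms) ≈c-refl
    ≲c-refl (opInf σ W)     = opInfʰ (≲v-refl W) ≈c-refl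
    ≲c-refl (opNInf σ V W)  = opNInfʰ (≲v-refl V) (≲v-refl W) ≈c-refl

    ≲cs-refl : ∀ {Γ τ n} (Ms : Vec (Γ ⊢c τ) n) → Γ ⊢ Ms ≲cs Ms
    ≲cs-refl []       = []
    ≲cs-refl (M ∷ Ms) = ≲c-refl M ∷ ≲cs-refl Ms

  -- No induction: transitivity of `R` absorbs the extra step into the one that closes the rule.
  ≲v-≈v : ∀ {Γ τ} {V W U : Γ ⊢v τ} → Γ ⊢ V ≲v W → Γ ⊢ W ≈v U → Γ ⊢ V ≲v U
  ≲v-≈v (varʰ b) b' = varʰ (≈v-trans b b')
  ≲v-≈v (*ʰ b)   b' = *ʰ (≈v-trans b b')
  ≲v-≈v (Zʰ b)   b' = Zʰ (≈v-trans b b')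
  ≲v-≈v (Sʰ h b) b' = Sʰ h (≈v-trans b b')
  ≲v-≈v (ƛʰ h b) b' = ƛʰ h (≈v-trans b b')

  ≲c-≈c : ∀ {Γ τ} {M P Q : Γ ⊢c τ} → Γ ⊢ M ≲c P → Γ ⊢ P ≈c Q → Γ ⊢ M ≲c Q
  ≲c-≈c (·ʰ h k b)       b' = ·ʰ h k (≈c-trans b b')
  ≲c-≈c (returnʰ h b)    b' = returnʰ h (≈c-trans b b')
  ≲c-≈c (lettʰ h k b)    b' = lettʰ h k (≈c-trans b b')
  ≲c-≈c (fixʰ h b)       b' = fixʰ h (≈c-trans b b')
  ≲c-≈c (caseʰ h k l b)  b' = caseʰ h k l (≈c-trans b b')
  ≲c-≈c (opFinʰ h b)     b' = opFinʰ h (≈c-trans b b')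
  ≲c-≈c (opNFinʰ h k b)  b' = opNFinʰ h k (≈c-trans b b')
  ≲c-≈c (opInfʰ h b)     b' = opInfʰ h (≈c-trans b b')
  ≲c-≈c (opNInfʰ h k b)  b' = opNInfʰ h k (≈c-trans b b')

  ≈v⇒≲v : ∀ {Γ τ} {V W : Γ ⊢v τ} → Γ ⊢ V ≈v W → Γ ⊢ V ≲v W
  ≈v⇒≲v {V = V} = ≲v-≈v (≲v-refl V)

  ≈c⇒≲c : ∀ {Γ τ} {M P : Γ ⊢c τ} → Γ ⊢ M ≈c P → Γ ⊢ M ≲c P
  ≈c⇒≲c {M = M} = ≲c-≈c (≲c-refl M)

  mutual
    ≲v-ren : ∀ {Γ Δ τ} {V W : Γ ⊢v τ} (r : Ren Γ Δ) → Γ ⊢ V ≲v W → Δ ⊢ renV r V ≲v renV r W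
    ≲v-ren r (varʰ b) = varʰ (≈v-ren r b)
    ≲v-ren r (*ʰ b)   = *ʰ (≈v-ren r b)
    ≲v-ren r (Zʰ b)   = Zʰ (≈v-ren r b)
    ≲v-ren r (Sʰ h b) = Sʰ (≲v-ren r h) (≈v-ren r b)
    ≲v-ren r (ƛʰ h b) = ƛʰ (≲c-ren (liftR r) h) (≈v-ren r b)

    ≲c-ren : ∀ {Γ Δ τ} {M P : Γ ⊢c τ} (r : Ren Γ Δ) → Γ ⊢ M ≲c P → Δ ⊢ renC r M ≲c renC r P
    ≲c-ren r (·ʰ h k b)      = ·ʰ (≲v-ren r h) (≲v-ren r k) (≈c-ren r b)
    ≲c-ren r (returnʰ h b)   = returnʰ (≲v-ren r h) (≈c-ren r b)
    ≲c-ren r (lettʰ h k b)   = lettʰ (≲c-ren r h) (≲c-ren (liftR r) k) (≈c-ren r b)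
    ≲c-ren r (fixʰ h b)      = fixʰ (≲v-ren r h) (≈c-ren r b)
    ≲c-ren r (caseʰ h k l b) =
      caseʰ (≲v-ren r h) (≲c-ren r k) (≲c-ren (liftR r) l) (≈c-ren r b)
    ≲c-ren r (opFinʰ h b)    = opFinʰ (≲cs-ren r h) (≈c-ren r b)
    ≲c-ren r (opNFinʰ h k b) = opNFinʰ (≲v-ren r h) (≲cs-ren r k) (≈c-ren r b)
    ≲c-ren r (opInfʰ h b)    = opInfʰ (≲v-ren r h) (≈c-ren r b)
    ≲c-ren r (opNInfʰ h k b) = opNInfʰ (≲v-ren r h) (≲v-ren r k) (≈c-ren r b)

    ≲cs-ren : ∀ {Γ Δ τ n} {Ms Ps : Vec (Γ ⊢c τ) n} (r : Ren Γ Δ) → Γ ⊢ Ms ≲cs Ps →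
              Δ ⊢ renCs r Ms ≲cs renCs r Ps
    ≲cs-ren r []       = []
    ≲cs-ren r (h ∷ hs) = ≲c-ren r h ∷ ≲cs-ren r hs

  infix 4 _≲s_

  _≲s_ : ∀ {Γ Δ} → Sub Γ Δ → Sub Γ Δ → Set
  _≲s_ {Γ} {Δ} s s' = ∀ {τ} (x : τ ∈ Γ) → Δ ⊢ s x ≲v s' x

  ≲s-lift : ∀ {Γ Δ ρ} {s s' : Sub Γ Δ} → s ≲s s' → liftS {ρ = ρ} s ≲s liftS s'
  ≲s-lift e (here _)  = ≲v-refl _
  ≲s-lift e (there x) = ≲v-ren there (e x)

  mutual
    -- The two substitutions may differ, as β-reduction and sequencing require: there the
    -- substituted values are merely Howe-related.
    ≲v-sub : ∀ {Γ Δ τ} {V W : Γ ⊢v τ} {s s' : Sub Γ Δ} → s ≲s s' →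
             Γ ⊢ V ≲v W → Δ ⊢ subV s V ≲v subV s' W
    -- `e` exchanges `s` for `s'` at `x`; the closing step of the rule is then instantiated with
    -- `s'` alone.
    ≲v-sub {s' = s'} e (varʰ {x = x} b) = ≲v-≈v (e x) (≈v-sub s' b)
    ≲v-sub {s' = s'} e (*ʰ b)   = *ʰ (≈v-sub s' b)
    ≲v-sub {s' = s'} e (Zʰ b)   = Zʰ (≈v-sub s' b)
    ≲v-sub {s' = s'} e (Sʰ h b) = Sʰ (≲v-sub e h) (≈v-sub s' b)
    ≲v-sub {s' = s'} e (ƛʰ h b) = ƛʰ (≲c-sub (≲s-lift e) h) (≈v-sub s' b)

    ≲c-sub : ∀ {Γ Δ τ} {M P : Γ ⊢c τ} {s s' : Sub Γ Δ} → s ≲s s' →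
             Γ ⊢ M ≲c P → Δ ⊢ subC s M ≲c subC s' P
    ≲c-sub {s' = s'} e (·ʰ h k b)      = ·ʰ (≲v-sub e h) (≲v-sub e k) (≈c-sub s' b)
    ≲c-sub {s' = s'} e (returnʰ h b)   = returnʰ (≲v-sub e h) (≈c-sub s' b)
    ≲c-sub {s' = s'} e (lettʰ h k b)   =
      lettʰ (≲c-sub e h) (≲c-sub (≲s-lift e) k) (≈c-sub s' b)
    ≲c-sub {s' = s'} e (fixʰ h b)      = fixʰ (≲v-sub e h) (≈c-sub s' b)
    ≲c-sub {s' = s'} e (caseʰ h k l b) =
      caseʰ (≲v-sub e h) (≲c-sub e k) (≲c-sub (≲s-lift e) l) (≈c-sub s' b)
    ≲c-sub {s' = s'} e (opFinʰ h b)    = opFinʰ (≲cs-sub e h) (≈c-sub s' b)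
    ≲c-sub {s' = s'} e (opNFinʰ h k b) = opNFinʰ (≲v-sub e h) (≲cs-sub e k) (≈c-sub s' b)
    ≲c-sub {s' = s'} e (opInfʰ h b)    = opInfʰ (≲v-sub e h) (≈c-sub s' b)
    ≲c-sub {s' = s'} e (opNInfʰ h k b) = opNInfʰ (≲v-sub e h) (≲v-sub e k) (≈c-sub s' b)

    ≲cs-sub : ∀ {Γ Δ τ n} {Ms Ps : Vec (Γ ⊢c τ) n} {s s' : Sub Γ Δ} → s ≲s s' →
              Γ ⊢ Ms ≲cs Ps → Δ ⊢ subCs s Ms ≲cs subCs s' Ps
    ≲cs-sub e []       = []
    ≲cs-sub e (h ∷ hs) = ≲c-sub e h ∷ ≲cs-sub e hs

  ≲c-unfold : ∀ {ρ τ} {F G : Val ((ρ ⇒ τ) ⇒ (ρ ⇒ τ))} → [] ⊢ F ≲v G →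
              [] ⊢ unfold F ≲c unfold G
  ≲c-unfold h =
    returnʰ (ƛʰ (lettʰ
      (·ʰ (≲v-ren there h)
          (ƛʰ (lettʰ (fixʰ (≲v-ren there (≲v-ren there h)) ≈c-refl) (≲c-refl _) ≈c-refl) ≈v-refl)
          ≈c-refl)
      (≲c-refl _) ≈c-refl) ≈v-refl) ≈c-refl

  ≲c-[] : ∀ {ρ τ} {M P : ρ ∷ [] ⊢c τ} {V W : Val ρ} →
          ρ ∷ [] ⊢ M ≲c P → [] ⊢ V ≲v W → [] ⊢ M [ V ] ≲c P [ W ]
  ≲c-[] {V = V} {W} h k = ≲c-sub single-≲ h
    where
    single-≲ : single V ≲s single W
    single-≲ (here refl) = k
    single-≲ (there ())

  module _ (R-sym : Symmetric R) where

    infixr 5 _˘◅v_ _˘◅c_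

    _˘◅v_ : ∀ {Γ τ} {V W U : Γ ⊢v τ} →
            Γ ⊢ W ≈v V → Star (Γ ⊢_≲v_) W U → Star (Γ ⊢_≲v_) V U
    b ˘◅v hs = ≈v⇒≲v (instV λ s → proj₁ R-sym (atV b s)) ◅ hs

    _˘◅c_ : ∀ {Γ τ} {M P Q : Γ ⊢c τ} →
            Γ ⊢ P ≈c M → Star (Γ ⊢_≲c_) P Q → Star (Γ ⊢_≲c_) M Q
    b ˘◅c hs = ≈c⇒≲c (instC λ s → proj₂ R-sym (atC b s)) ◅ hs

    mutual
      -- The closing step is flipped by symmetry of `R` and goes first. Then the chains for the
      -- subterms run one argument at a time, the other arguments being held fixed by reflexivity.
      ≲v-sym : ∀ {Γ τ} {V W : Γ ⊢v τ} → Γ ⊢ V ≲v W → Star (Γ ⊢_≲v_) W V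
      ≲v-sym (varʰ b) = b ˘◅v ε
      ≲v-sym (*ʰ b)   = b ˘◅v ε
      ≲v-sym (Zʰ b)   = b ˘◅v ε
      ≲v-sym (Sʰ h b) = b ˘◅v gmap S (λ h → Sʰ h ≈v-refl) (≲v-sym h)
      ≲v-sym (ƛʰ h b) = b ˘◅v gmap ƛ (λ h → ƛʰ h ≈v-refl) (≲c-sym h)

      ≲c-sym : ∀ {Γ τ} {M P : Γ ⊢c τ} → Γ ⊢ M ≲c P → Star (Γ ⊢_≲c_) P M
      ≲c-sym (·ʰ {V = V} {W' = W'} h k b) = b ˘◅c
        (gmap (_· W') (λ h → ·ʰ h (≲v-refl _) ≈c-refl) (≲v-sym h) ◅◅
         gmap (V ·_) (λ k → ·ʰ (≲v-refl _) k ≈c-refl) (≲v-sym k))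
      ≲c-sym (returnʰ h b) = b ˘◅c gmap return (λ h → returnʰ h ≈c-refl) (≲v-sym h)
      ≲c-sym (lettʰ {M = M} {P' = P'} h k b) = b ˘◅c
        (gmap (λ M → lett M P') (λ h → lettʰ h (≲c-refl _) ≈c-refl) (≲c-sym h) ◅◅
         gmap (lett M) (λ k → lettʰ (≲c-refl _) k ≈c-refl) (≲c-sym k))
      ≲c-sym (fixʰ h b) = b ˘◅c gmap fix (λ h → fixʰ h ≈c-refl) (≲v-sym h)
      ≲c-sym (caseʰ {V = V} {M = M} {M'} {P' = P'} h k l b) = b ˘◅c
        (gmap (λ V → case V M' P')
           (λ h → caseʰ h (≲c-refl _) (≲c-refl _) ≈c-refl) (≲v-sym h) ◅◅
         gmap (λ M → case V M P')
           (λ k → caseʰ (≲v-refl _) k (≲c-refl _) ≈c-refl) (≲c-sym k) ◅◅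
         gmap (case V M)
           (λ l → caseʰ (≲v-refl _) (≲c-refl _) l ≈c-refl) (≲c-sym l))
      ≲c-sym (opFinʰ h b) = b ˘◅c gmap (opFin _) (λ h → opFinʰ h ≈c-refl) (≲cs-sym h)
      ≲c-sym (opNFinʰ {σ = σ} {V = V} {Ms' = Ms'} h k b) = b ˘◅c
        (gmap (λ V → opNFin σ V Ms') (λ h → opNFinʰ h (≲cs-refl _) ≈c-refl) (≲v-sym h) ◅◅
         gmap (opNFin σ V) (λ k → opNFinʰ (≲v-refl _) k ≈c-refl) (≲cs-sym k))
      ≲c-sym (opInfʰ h b) = b ˘◅c gmap (opInf _) (λ h → opInfʰ h ≈c-refl) (≲v-sym h)
      ≲c-sym (opNInfʰ {σ = σ} {V = V} {W' = W'} h k b) = b ˘◅c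
        (gmap (λ V → opNInf σ V W') (λ h → opNInfʰ h (≲v-refl _) ≈c-refl) (≲v-sym h) ◅◅
         gmap (opNInf σ V) (λ k → opNInfʰ (≲v-refl _) k ≈c-refl) (≲v-sym k))

      ≲cs-sym : ∀ {Γ τ n} {Ms Ps : Vec (Γ ⊢c τ) n} → Γ ⊢ Ms ≲cs Ps → Star (Γ ⊢_≲cs_) Ps Ms
      ≲cs-sym []                       = ε
      ≲cs-sym (_∷_ {x = M} {ys = Ps} h hs) =
        gmap (_∷ Ps) (λ h → h ∷ ≲cs-refl _) (≲c-sym h) ◅◅
        gmap (M ∷_) (λ hs → ≲c-refl _ ∷ hs) (≲cs-sym hs)

  -- If R contains the closed part of its Howe closure then R ° is its Howe
  -- closure, and so inherits compatibility.
  module _ (⊆V : ∀ {τ} {V W : Val τ} → [] ⊢ V ≲v W → onVal R V W)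
           (⊆C : ∀ {τ} {M P : Com τ} → [] ⊢ M ≲c P → onCom R M P) where

    toV : ∀ {Γ τ} (V W : Γ ⊢v τ) → onVal° (R °) Γ V W → Γ ⊢ V ≲v W
    toV V W b = ≈v⇒≲v (instV b)

    toC : ∀ {Γ τ} (M P : Γ ⊢c τ) → onCom° (R °) Γ M P → Γ ⊢ M ≲c P
    toC M P b = ≈c⇒≲c (instC b)

    toCs : ∀ {Γ τ n} {Ms Ps : Vec (Γ ⊢c τ) n} →
           Pointwise (λ M P → onCom° (R °) Γ M P) Ms Ps → Γ ⊢ Ms ≲cs Ps
    toCs = Pointwise.map (toC _ _)

    fromV : ∀ {Γ τ} {V W : Γ ⊢v τ} → Γ ⊢ V ≲v W → onVal° (R °) Γ V W
    fromV h s = ⊆V (≲v-sub (λ x → ≲v-refl (s x)) h)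

    fromC : ∀ {Γ τ} {M P : Γ ⊢c τ} → Γ ⊢ M ≲c P → onCom° (R °) Γ M P
    fromC h s = ⊆C (≲c-sub (λ x → ≲v-refl (s x)) h)

    open Compatible

    °-compatible : Compatible (R °)
    °-compatible .var-compat x s = proj₁ R-refl refl
    °-compatible .*-compat s     = proj₁ R-refl refl
    °-compatible .Z-compat s     = proj₁ R-refl refl
    °-compatible .S-compat {V = V} {V'} h = fromV (Sʰ (toV V V' h) ≈v-refl)
    °-compatible .ƛ-compat {M = M} {M'} h = fromV (ƛʰ (toC M M' h) ≈v-refl)
    °-compatible .·-compat {V = V} {V'} {W} {W'} h k =
      fromC (·ʰ (toV V V' h) (toV W W' k) ≈c-refl)
    °-compatible .return-compat {V = V} {V'} h = fromC (returnʰ (toV V V' h) ≈c-refl)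
    °-compatible .let-compat {M = M} {M'} {P} {P'} h k =
      fromC (lettʰ (toC M M' h) (toC P P' k) ≈c-refl)
    °-compatible .fix-compat {V = V} {V'} h = fromC (fixʰ (toV V V' h) ≈c-refl)
    °-compatible .case-compat {V = V} {V'} {M} {M'} {P} {P'} h k l =
      fromC (caseʰ (toV V V' h) (toC M M' k) (toC P P' l) ≈c-refl)
    °-compatible .opFin-compat σ hs = fromC (opFinʰ (toCs hs) ≈c-refl)
    °-compatible .opNFin-compat σ {V} {V'} h ks =
      fromC (opNFinʰ (toV V V' h) (toCs ks) ≈c-refl)
    °-compatible .opInf-compat σ {W} {W'} h = fromC (opInfʰ (toV W W' h) ≈c-refl)
    °-compatible .opNInf-compat σ {V} {V'} {W} {W'} h k =
      fromC (opNInfʰ (toV V V' h) (toV W W' k) ≈c-refl)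

-- The Howe closure of bisimilarity is contained in bisimilarity.

module Bisimilarity (Op : Signature) {O : Set} (⟦_⟧ : O → Pred (Language.T Op ⊤) 0ℓ)
                    (open-⟦⟧ : ∀ o → Language.ScottOpen Op ⟦ o ⟧)
                    (dec : Language.Modalities.Decomposable Op ⟦_⟧)
                    (B : Language.TypedRel Op)
                    (isB : Language.Modalities.IsBisimilarity Op ⟦_⟧ B) where
  open Language Op
  open Modalities ⟦_⟧
  open Trees Op
  open Lifting Op ⟦_⟧ open-⟦⟧
  open Relations Op

  B-sym : Symmetric B
  B-sym = symmetric isB

  B-sim : IsSimulation B
  B-sim = simulation isB

  identity-simulation : IsSimulation identity
  identity-simulation .sim-N e      = e
  identity-simulation .sim-c refl   = Lift-refl refl
  identity-simulation .sim-⇒ refl U = refl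

  -- `largest` is the means of entering `B`: reflexivity, transitivity and the final inclusion each
  -- exhibit a symmetric simulation.
  B-refl : Reflexive B
  B-refl = largest isB identity (sym , sym) identity-simulation

  ⨾-simulation : IsSimulation (B ⨾ B)
  ⨾-simulation .sim-N (_ , b , c)   = trans (sim-N B-sim b) (sim-N B-sim c)
  ⨾-simulation .sim-c (_ , b , c)   =
    Lift-trans (λ b c → _ , b , c) (sim-c B-sim b) (sim-c B-sim c)
  ⨾-simulation .sim-⇒ (_ , b , c) U = _ , sim-⇒ B-sim b U , sim-⇒ B-sim c U

  B-trans : Transitive B
  B-trans = largest isB (B ⨾ B)
    ( (λ (_ , b , c) → _ , proj₁ B-sym c , proj₁ B-sym b)
    , (λ (_ , b , c) → _ , proj₂ B-sym c , proj₂ B-sym b))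
    ⨾-simulation

  open HoweClosure Op B B-refl B-trans

  -- A closed value of type `N` is built from `Z` and `S`, and bisimilarity at `N` is contained in
  -- equality.
  ≲v-N : ∀ {V W : Val N} → [] ⊢ V ≲v W → V ≡ W
  ≲v-N (Zʰ b)   = sim-N B-sim (≈v-close b)
  ≲v-N (Sʰ h b) = trans (cong S (≲v-N h)) (sim-N B-sim (≈v-close b))

  infix 4 _⊑≲_

  _⊑≲_ : ∀ {τ} → T (Val τ) → T (Val τ) → Set₁
  _⊑≲_ = Lift ([] ⊢_≲v_)

  ⊑≲-≈c : ∀ {τ} {t : T (Val τ)} {M P : Com τ} → t ⊑≲ ∣ M ∣ → [] ⊢ M ≈c P → t ⊑≲ ∣ P ∣
  ⊑≲-≈c l b =
    Lift-trans (λ h c → ≲v-≈v h (≈v-open c)) l (sim-c B-sim (≈c-close b))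

  ⊑≲-next : ∀ {τ} {t : T (Val τ)} {M M' : Com τ} → step M ≡ next M' → t ⊑≲ ∣ M' ∣ → t ⊑≲ ∣ M ∣
  ⊑≲-next e = Lift-⊑ (λ h → h) (⊑-next e)

  ⊑≲-op : ∀ {τ} {M : Com τ} {ν} {f : Branch ν → T (Val τ)} {k} → step M ≡ op ν k →
          (∀ i → f i ⊑≲ ∣ k i ∣) → bind (nodeT ν) f ⊑≲ ∣ M ∣
  ⊑≲-op {ν = ν} {f} {k} e l =
    Lift-⊑ (λ h → h) (bind-⊑-op e)
      (Lift-bind dec {Q = _≡_} {t = nodeT ν} {nodeT ν} {f} {λ i → ∣ k i ∣}
        (Lift-refl refl) λ { {i} refl → l i })

  -- Induction on fuel, with inversion of the derivation. Derivations cannot be the measure, since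
  -- β-reduction and unfolding produce new ones by substitution.
  approx-⊑≲ : ∀ n {τ} {M P : Com τ} → [] ⊢ M ≲c P → approx n M ⊑≲ ∣ P ∣
  -- A modality may accept the tree `⊥`; by upward closure it then accepts every tree.
  approx-⊑≲ zero h A o m = upward (open-⟦⟧ o) (λ { ((_ , ()) , _) }) m
  approx-⊑≲ (suc n) (·ʰ (ƛʰ h b) k c) =
    -- The Howe-related body belongs to the intermediate abstraction, not to the right-hand
    -- function. So the former is reduced, and `sim-⇒` passes from its application to that of the
    -- latter.
    ⊑≲-≈c (⊑≲-next refl (approx-⊑≲ n (≲c-[] h k)))
      (≈c-open (proj₂ B-trans (_ , sim-⇒ B-sim (≈v-close b) _ , ≈c-close c)))
  approx-⊑≲ (suc n) (returnʰ {V' = V'} h c) =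
    ⊑≲-≈c (Lift-⊑ (λ h → h) leaf-⊑ (Lift-leaf h)) c
    where
    leaf-⊑ : leafT V' ⊑ ∣ return V' ∣
    leaf-⊑ (at (_ , leaf) refl) = at (_ , leaf refl) refl
  approx-⊑≲ (suc n) (lettʰ {M' = M'} {P' = P'} h k c) =
    ⊑≲-≈c
      (Lift-⊑ (λ h → h) (bind-⊑-let M' P')
        -- The returned values are related by the Howe closure only, so body and argument of the
        -- continuation change together.
        (Lift-bind dec (approx-⊑≲ n h) (λ l → approx-⊑≲ n (≲c-[] k l))))
      c
  approx-⊑≲ (suc n) (fixʰ h c) = ⊑≲-≈c (⊑≲-next refl (approx-⊑≲ n (≲c-unfold h))) c
  -- Bisimilar numerals are equal, so both sides take the same branch.
  approx-⊑≲ (suc n) (caseʰ (Zʰ b) k l c) with sim-N B-sim (≈v-close b)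
  ... | refl = ⊑≲-≈c (⊑≲-next refl (approx-⊑≲ n k)) c
  approx-⊑≲ (suc n) (caseʰ (Sʰ h b) k l c) with sim-N B-sim (≈v-close b)
  ... | refl = ⊑≲-≈c (⊑≲-next refl (approx-⊑≲ n (≲c-[] l h))) c
  approx-⊑≲ (suc n) (opFinʰ h c) =
    ⊑≲-≈c (⊑≲-op refl (λ i → approx-⊑≲ n (Pointwise.lookup h i))) c
  approx-⊑≲ (suc n) (opNFinʰ h k c) with ≲v-N h
  ... | refl = ⊑≲-≈c (⊑≲-op refl (λ i → approx-⊑≲ n (Pointwise.lookup k i))) c
  approx-⊑≲ (suc n) (opInfʰ h c) =
    ⊑≲-≈c (⊑≲-op refl (λ m → approx-⊑≲ n (·ʰ h (≲v-refl _) ≈c-refl))) c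
  approx-⊑≲ (suc n) (opNInfʰ h k c) with ≲v-N h
  ... | refl = ⊑≲-≈c (⊑≲-op refl (λ m → approx-⊑≲ n (·ʰ k (≲v-refl _) ≈c-refl))) c

  ≲c-lift : ∀ {τ} {M P : Com τ} → [] ⊢ M ≲c P → ∣ M ∣ ⊑≲ ∣ P ∣
  ≲c-lift {M = M} h A o m =
    let n , m' = chain (open-⟦⟧ o) (λ n → approx n M [∈ A ])
                   (λ n → restrict-⊑ {P = A} (approx-suc n M) (λ a → a))
                   (∣ M ∣ [∈ A ]) (approx-sup M A) m
    in approx-⊑≲ n h A o m'

  howe* : TypedRel
  howe* .onVal = Star ([] ⊢_≲v_)
  howe* .onCom = Star ([] ⊢_≲c_)

  star-sym : ∀ {X : Set} {R : Rel X 0ℓ} → (∀ {x y} → R x y → Star R y x) →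
             ∀ {x y} → Star R x y → Star R y x
  star-sym f ε        = ε
  star-sym f (h ◅ hs) = star-sym f hs ◅◅ f h

  howe*-symmetric : Symmetric howe*
  howe*-symmetric = star-sym (≲v-sym B-sym)
                  , star-sym (≲c-sym B-sym)

  -- Each clause passes along a chain link by link: equalities and liftings compose, and application
  -- to a fixed `U` is an instance of a Howe rule.
  howe*-simulation : IsSimulation howe*
  howe*-simulation .sim-N ε          = refl
  howe*-simulation .sim-N (h ◅ hs)   = trans (≲v-N h) (howe*-simulation .sim-N hs)
  howe*-simulation .sim-c ε          = Lift-refl ε
  howe*-simulation .sim-c (h ◅ hs)   = Lift-trans _◅_ (≲c-lift h) (howe*-simulation .sim-c hs)
  howe*-simulation .sim-⇒ hs U       = gmap (_· U) (λ h → ·ʰ h (≲v-refl U) ≈c-refl) hs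

  howe*-⊆ : howe* ⊆ B
  howe*-⊆ = largest isB howe* howe*-symmetric howe*-simulation

  bisimilarity°-compatible : Compatible (B °)
  bisimilarity°-compatible =
    °-compatible (λ h → proj₁ howe*-⊆ (h ◅ ε)) (λ h → proj₂ howe*-⊆ (h ◅ ε))

theorem3 : (Op : Signature) → let open Language Op in
    {O : Set} (⟦_⟧ : O → Pred (T ⊤) 0ℓ) → let open Modalities ⟦_⟧ in
    (∀ o → ScottOpen ⟦ o ⟧) → Decomposable →
    (B : TypedRel) → IsBisimilarity B → Compatible (B °)
theorem3 Op ⟦_⟧ open-⟦⟧ dec B isB =
  Bisimilarity.bisimilarity°-compatible Op ⟦_⟧ open-⟦⟧ dec B isB
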